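{- (Uniform Craig interpolation for ITL-NL.) Let $A$ and $B$ be ITL-NL formulas. If $\models A\supset B$, then there exists an ITL-NL formula $C$ such that $\mathrm{Var}(C)\subseteq\mathrm{Var}(A)\cap\mathrm{Var}(B)$, $\models A\supset C$ and $\models C\supset B$. Moreover, $C$ can be determined from $A$ only and serve all $B$ producing the same $\mathrm{Var}(A)\cap\mathrm{Var}(B)$: for every ITL-NL formula $A$ and every $U\subseteq\mathrm{Var}(A)$ there is an ITL-NL formula $C$ with $\mathrm{Var}(C)\subseteq U$ such that $\models A\supset C$ and $\models C\supset B$ for every ITL-NL formula $B$ with $\mathrm{Var}(A)\cap\mathrm{Var}(B)=U$ and $\models A\supset B$.
   Context: $V$ is a vocabulary of propositional variables and $\Sigma=\mathcal P(V)$. ITL-NL formulas: $A::=\bot\mid q\mid A\supset A\mid\bigcirc A\mid A;A\mid A^*\mid\Diamond_l A\mid\Diamond_r A$, with $q\in V$; $\mathrm{Var}(A)$ is the set of variables occurring in $A$. For $\sigma:\mathbb Z\to\Sigma$ and integers $i\le j$: $\sigma,i,j\not\models\bot$; $\sigma,i,j\models q$ iff $q\in\sigma^i$; $\sigma,i,j\models A\supset B$ iff $\sigma,i,j\not\models A$ or $\sigma,i,j\models B$; $\sigma,i,j\models\bigcirc A$ iff $i<j$ and $\sigma,i+1,j\models A$; $\sigma,i,j\models A;B$ iff $\sigma,i,k\models A$ and $\sigma,k,j\models B$ for some $k\in\{i,\ldots,j\}$; $\sigma,i,j\models A^*$ iff $i=j$ or there are $k_0=i<k_1<\cdots<k_N=j$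 with $\sigma,k_{n-1},k_n\models A$ for $n=1,\ldots,N$; $\sigma,i,j\models\Diamond_l A$ iff $\sigma,k,i\models A$ for some $k\le i$; $\sigma,i,j\models\Diamond_r A$ iff $\sigma,j,k\models A$ for some $k\ge j$. $\models A$ means $\sigma,i,j\models A$ for all $\sigma:\mathbb Z\to\Sigma$ and all $i\le j$. -}

module Defs where

open import Data.Empty using (⊥)
open import Data.Integer using (ℤ; _+_; _≤_; _<_; 1ℤ)
open import Data.Product using (_×_; ∃-syntax)
open import Data.Sum using (_⊎_)
open import Level using (0ℓ)
open import Relation.Binary.Construct.Closure.ReflexiveTransitive using (Star)
open import Relation.Nullary using (¬_)
open import Relation.Unary using (Pred; _∈_; _∪_; ∅; ｛_｝)

infix  9 _*
infix  8 ○_ ◊l_ ◊r_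
infixr 7 _⨾_
infixr 6 _⊃_
infix  4 _[_,_]⊨_
infix  3 ⊨_

-- `_⨾_` is chop, written `;` in ITL (a reserved symbol in Agda).
data Formula (V : Set) : Set where
  ⊥′    : Formula V
  var   : V → Formula V
  _⊃_   : Formula V → Formula V → Formula V
  ○_    : Formula V → Formula V
  _⨾_   : Formula V → Formula V → Formula V
  _*    : Formula V → Formula V
  ◊l_   : Formula V → Formula V
  ◊r_   : Formula V → Formula V

Var : {V : Set} → Formula V → Pred V 0ℓ
Var ⊥′      = ∅
Var (var q) = ｛ q ｝
Var (A ⊃ B) = Var A ∪ Var B
Var (○ A)   = Var A
Var (A ⨾ B) = Var A ∪ Var B
Var (A *)   = Var A
Var (◊l A)  = Var A
Var (◊r A)  = Var A

Trace : Set → Set₁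
Trace V = ℤ → Pred V 0ℓ

-- Only meaningful for i ≤ j, an invariant that every clause preserves.
-- In the clause for `A *`, a `Star` from i to j is a chain
-- i = k₀ < k₁ < … < k_N = j with A holding on each [kₙ₋₁ , kₙ];
-- the empty chain is the case i = j.
_[_,_]⊨_ : {V : Set} → Trace V → ℤ → ℤ → Formula V → Set
σ [ i , j ]⊨ ⊥′      = ⊥
σ [ i , j ]⊨ var q   = q ∈ σ i
σ [ i , j ]⊨ (A ⊃ B) = (¬ σ [ i , j ]⊨ A) ⊎ (σ [ i , j ]⊨ B)
σ [ i , j ]⊨ (○ A)   = i < j × σ [ i + 1ℤ , j ]⊨ A
σ [ i , j ]⊨ (A ⨾ B) = ∃[ k ] i ≤ k × k ≤ j × σ [ i , k ]⊨ A × σ [ k , j ]⊨ B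
σ [ i , j ]⊨ (A *)   = Star (λ k k′ → k < k′ × σ [ k , k′ ]⊨ A) i j
σ [ i , j ]⊨ (◊l A)  = ∃[ k ] k ≤ i × σ [ k , i ]⊨ A
σ [ i , j ]⊨ (◊r A)  = ∃[ k ] j ≤ k × σ [ j , k ]⊨ A

⊨_ : {V : Set} → Formula V → Set₁
⊨_ {V} A = (σ : Trace V) (i j : ℤ) → i ≤ j → σ [ i , j ]⊨ A

-- The interpolant is the uniform one, ∃p₁…pₙ. A for the variables pᵢ of A outside U, so the point
-- is that ITL-NL is closed under quantification over propositions on ℤ-words.  Satisfaction of A is
-- definable in monadic second-order logic over (ℤ, <), and, as in Shelah's composition method, an
-- MSO-definable property of a word assigns to each segment of the word a type from a finite set such
-- that the type of a word is determined by the types of the blocks into which it is cut; quantification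
-- over a proposition replaces types by sets of types.  So ∃p₁…pₙ. A at [i , j] depends only on the types
-- of (-∞ , i), [i , j) and [j , ∞).  "The type of [i , j) is x" is a regular property of the segment,
-- expressed with chop and star by Kleene's construction.  For the infinite parts, Ramsey's theorem gives
-- a factorisation into one block of type s and infinitely many of type e, and the existence of one for
-- given s and e can be expressed by nesting ◊r (resp. ◊l) and negation.
module Submission where

open import Axiom.ExcludedMiddle using (ExcludedMiddle)
open import Data.Bool using (Bool; true; false; T)
open import Data.Empty using (⊥; ⊥-elim)
open import Data.Fin using (Fin; zero; suc; combine; funToFin; finToFun; toℕ)
import Data.Fin.Properties as Fin
open import Data.Integer using (ℤ; -[1+_]; 0ℤ; 1ℤ; -1ℤ; _+_; _-_; -_; _≤_; _<_; _≤?_; _≟_)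
  renaming (+_ to pos)
import Data.Integer as ℤ
import Data.Integer.Properties as ℤ
open import Data.Integer.Tactic.RingSolver using (solve-∀)
open import Data.List as List using (List; []; _∷_; allFin)
open import Data.List.Membership.Propositional using () renaming (_∈_ to _∈ₗ_)
open import Data.List.Membership.Propositional.Properties using (∈-allFin; ∈-filter⁺; ∈-filter⁻; ∈-++⁺ˡ; ∈-++⁺ʳ)
import Data.List.Properties as List
open import Data.List.Relation.Unary.Any using (here; there)
open import Data.Nat as ℕ using (ℕ; zero; suc; _^_; z≤n; s≤s)
import Data.Nat.Properties as ℕ
open import Data.Product using (_×_; _,_; ∃-syntax; ∃₂; proj₁; proj₂; map₂)
open import Data.Sum using (_⊎_; inj₁; inj₂)
open import Data.Unit using (⊤; tt)
open import Data.Vec as Vec using (Vec; []; _∷_; lookup; head; tail)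
open import Data.Vec.Properties using (lookup-map)
open import Function using (_∘_; id; const; _⇔_; mk⇔)
open import Function.Bundles using (Equivalence)
open import Level using (0ℓ)
open import Relation.Binary using (_Preserves_⟶_; tri<; tri≈; tri>)
open import Relation.Binary.Construct.Closure.ReflexiveTransitive as Star using (Star; ε; _◅_; _◅◅_)
open import Relation.Binary.PropositionalEquality
open import Relation.Nullary using (¬_; Dec; yes; no; does; contradiction)
open import Relation.Nullary.Decidable using (dec-true; dec-false; decidable-stable)
open import Relation.Unary using (Pred; _∈_; _∩_; _⊆_; _≐_; U)
open import Defs

open Equivalence using (to; from)

module Classical (lem : ExcludedMiddle 0ℓ) where

  -- Classical connectives and the numbering of subsets of a finite set.

  →⇒¬⊎ : ∀ {P Q : Set} → (P → Q) → (¬ P) ⊎ Q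
  →⇒¬⊎ {P} f with lem {P}
  ... | yes p = inj₂ (f p)
  ... | no ¬p = inj₁ ¬p

  ¬⊎⇒→ : ∀ {P Q : Set} → (¬ P) ⊎ Q → P → Q
  ¬⊎⇒→ (inj₁ ¬p) p = contradiction p ¬p
  ¬⊎⇒→ (inj₂ q)  _ = q

  flag : Set → Fin 2
  flag P with lem {P}
  ... | yes _ = suc zero
  ... | no _  = zero

  flag-reflects : ∀ {P Q} → flag P ≡ flag Q → P → Q
  flag-reflects {P} {Q} eq p with lem {P} | lem {Q}
  ... | _     | yes q = q
  ... | no ¬p | no _  = contradiction p ¬p
  flag-reflects () p | yes _ | no _

  flag-cong : ∀ {P Q} → (P → Q) → (Q → P) → flag P ≡ flag Q
  flag-cong {P} {Q} f g with lem {P} | lem {Q}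
  ... | yes _ | yes _ = refl
  ... | no _  | no _  = refl
  ... | yes p | no ¬q = contradiction (f p) ¬q
  ... | no ¬p | yes q = contradiction (g q) ¬p

  funToFin-cong : ∀ {m n} {f g : Fin m → Fin n} → f ≗ g → funToFin f ≡ funToFin g
  funToFin-cong {zero}  f≗g = refl
  funToFin-cong {suc m} f≗g = cong₂ combine (f≗g zero) (funToFin-cong (f≗g ∘ suc))

  -- Makes a set of types a type again: the 2 ^ N subsets of `Fin N` are numbered through their
  -- characteristic functions.
  code : ∀ {N} → Pred (Fin N) 0ℓ → Fin (2 ^ N)
  code P = funToFin (flag ∘ P)

  code-reflects : ∀ {N} {P Q : Pred (Fin N) 0ℓ} → code P ≡ code Q → P ⊆ Q
  code-reflects {P = P} {Q} eq {t} = flag-reflects (trans (sym (Fin.finToFun-funToFin (flag ∘ P) t))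
    (trans (cong (λ c → finToFun c t) eq) (Fin.finToFun-funToFin (flag ∘ Q) t)))

  code-cong : ∀ {N} {P Q : Pred (Fin N) 0ℓ} → P ⊆ Q → Q ⊆ P → code P ≡ code Q
  code-cong {N} P⊆Q Q⊆P = funToFin-cong {N} (λ _ → flag-cong P⊆Q Q⊆P)

  -- Composition of types along monotone block maps.

  Mono : (ℤ → ℤ) → Set
  Mono β = β Preserves _≤_ ⟶ _≤_

  Word : Set → Set
  Word Σ = ℤ → Σ

  _↾_ : Pred ℤ 0ℓ × (ℤ → ℤ) → ℤ → Pred ℤ 0ℓ
  ((D , β) ↾ n) k = k ∈ D × β k ≡ n

  -- Types of words restricted to a set of positions: `point` makes the type of a single position depend
  -- on its letter only, and `sum` makes the type of D depend only on the types of the blocks β⁻¹ n.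
  record Types (Σ : Set) : Set₁ where
    field
      N     : ℕ
      ty    : Word Σ → Pred ℤ 0ℓ → Fin N
      point : ∀ {w w′ : Word Σ} {D D′ k k′} → D ⊆ (k ≡_) → D′ ⊆ (k′ ≡_) →
              (k ∈ D → k′ ∈ D′) → (k′ ∈ D′ → k ∈ D) → (k ∈ D → w k ≡ w′ k′) → ty w D ≡ ty w′ D′
      sum   : ∀ {w w′ : Word Σ} {D D′ β β′} → Mono β → Mono β′ →
              (∀ n → ty w ((D , β) ↾ n) ≡ ty w′ ((D′ , β′) ↾ n)) → ty w D ≡ ty w′ D′

    -- With the identity as block map every block has at most one position, so `point` compares the
    -- words letter by letter.
    local : ∀ {w w′ D D′} → D ⊆ D′ → D′ ⊆ D → (∀ {k} → k ∈ D → w k ≡ w′ k) → ty w D ≡ ty w′ D′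
    local {w} {w′} {D} {D′} D⊆D′ D′⊆D w≈w′ = sum {β = id} {id} id id λ n →
      point {k = n} {n} (sym ∘ proj₂) (sym ∘ proj₂)
        (λ (n∈D , e) → D⊆D′ n∈D , e) (λ (n∈D′ , e) → D′⊆D n∈D′ , e) (w≈w′ ∘ proj₁)

    cut : ∀ {w w′ D D′} c c′ → ty w (D ∩ (_< c)) ≡ ty w′ (D′ ∩ (_< c′)) →
          ty w (D ∩ (c ≤_)) ≡ ty w′ (D′ ∩ (c′ ≤_)) → ty w D ≡ ty w′ D′
    cut {w} {w′} {D} {D′} c c′ lo hi = sum (mono c) (mono c′) block
      where
      side : ℤ → ℤ → ℤ
      side c k with c ≤? k
      ... | yes _ = 1ℤ
      ... | no _  = 0ℤ
      mono : ∀ c → Mono (side c)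
      mono c {k} {m} k≤m with c ≤? k | c ≤? m
      ... | yes _   | yes _  = ℤ.≤-refl
      ... | yes c≤k | no c≰m = contradiction (ℤ.≤-trans c≤k k≤m) c≰m
      ... | no _    | yes _  = ℤ.i≤i+j 0ℤ 1ℤ
      ... | no _    | no _   = ℤ.≤-refl
      side-lo : ∀ c {k} → k < c → side c k ≡ 0ℤ
      side-lo c {k} k<c with c ≤? k
      ... | yes c≤k = contradiction k<c (ℤ.≤⇒≯ c≤k)
      ... | no _    = refl
      side-hi : ∀ c {k} → c ≤ k → side c k ≡ 1ℤ
      side-hi c {k} c≤k with c ≤? k
      ... | yes _  = refl
      ... | no c≰k = contradiction c≤k c≰k
      lo-side : ∀ c {k} → side c k ≡ 0ℤ → k < c
      lo-side c {k} e with c ≤? k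
      ... | no c≰k = ℤ.≰⇒> c≰k
      lo-side c {k} () | yes _
      hi-side : ∀ c {k} → side c k ≡ 1ℤ → c ≤ k
      hi-side c {k} e with c ≤? k
      ... | yes c≤k = c≤k
      hi-side c {k} () | no _
      off : ∀ c {n k} → n ≢ 0ℤ → n ≢ 1ℤ → ¬ (side c k ≡ n)
      off c {n} {k} n≢0 n≢1 e with c ≤? k
      ... | yes _ = n≢1 (sym e)
      ... | no _  = n≢0 (sym e)
      block : ∀ n → ty w ((D , side c) ↾ n) ≡ ty w′ ((D′ , side c′) ↾ n)
      block n with n ≟ 0ℤ | n ≟ 1ℤ
      ... | yes refl | _ = trans (local (map₂ (lo-side c)) (map₂ (side-lo c)) (λ _ → refl))
              (trans lo (local (map₂ (side-lo c′)) (map₂ (lo-side c′)) (λ _ → refl)))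
      ... | no _ | yes refl = trans (local (map₂ (hi-side c)) (map₂ (side-hi c)) (λ _ → refl))
              (trans hi (local (map₂ (side-hi c′)) (map₂ (hi-side c′)) (λ _ → refl)))
      -- All remaining blocks are empty, so the demands of `point` hold vacuously at the arbitrary
      -- position 0.
      ... | no n≢0 | no n≢1 = point {k = 0ℤ} {0ℤ}
              (λ (_ , e) → contradiction e (off c n≢0 n≢1)) (λ (_ , e) → contradiction e (off c′ n≢0 n≢1))
              (λ (_ , e) → contradiction e (off c n≢0 n≢1)) (λ (_ , e) → contradiction e (off c′ n≢0 n≢1))
              (λ (_ , e) → contradiction e (off c n≢0 n≢1))

  open Types

  -- The type of w on D is the set of all t with P t w D; it suffices to check the axioms in one direction.
  fromPred : ∀ {Σ} N (P : Fin N → Word Σ → Pred ℤ 0ℓ → Set) →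
    (∀ t {w w′ D D′ k k′} → D ⊆ (k ≡_) → (k ∈ D → k′ ∈ D′) → (k′ ∈ D′ → k ∈ D) → D′ ⊆ (k′ ≡_) →
      (k ∈ D → w k ≡ w′ k′) → P t w D → P t w′ D′) →
    (∀ t {w w′ D D′ β β′} → Mono β → Mono β′ →
      (∀ n t → P t w ((D , β) ↾ n) → P t w′ ((D′ , β′) ↾ n)) →
      (∀ n t → P t w′ ((D′ , β′) ↾ n) → P t w ((D , β) ↾ n)) → P t w D → P t w′ D′) →
    Types Σ
  fromPred N P pt sm .N = 2 ^ N
  fromPred N P pt sm .ty w D = code (λ t → P t w D)
  fromPred N P pt sm .point D⊆ D′⊆ f g eq = code-cong
    (λ {t} → pt t D⊆ f g D′⊆ eq) (λ {t} → pt t D′⊆ g f D⊆ (λ k′∈D′ → sym (eq (g k′∈D′))))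
  fromPred N P pt sm .sum β↑ β′↑ eq = code-cong
    (λ {t} → sm t β↑ β′↑ (λ n t → code-reflects (eq n) {t}) (λ n t → code-reflects (sym (eq n)) {t}))
    (λ {t} → sm t β′↑ β↑ (λ n t → code-reflects (sym (eq n)) {t}) (λ n t → code-reflects (eq n) {t}))

  -- Basic types, products, projection and reversal.

  Occurs : ∀ {Σ} → Pred Σ 0ℓ → Word Σ → Pred ℤ 0ℓ → Set
  Occurs c w D = ∃[ k ] k ∈ D × w k ∈ c

  Precedes : ∀ {Σ} → Pred Σ 0ℓ → Pred Σ 0ℓ → Word Σ → Pred ℤ 0ℓ → Set
  Precedes a b w D = ∃₂ λ k m → k ∈ D × m ∈ D × k < m × w k ∈ a × w m ∈ b

  occurs-point : ∀ {Σ} (c : Pred Σ 0ℓ) {w w′ D D′ k k′} → D ⊆ (k ≡_) → (k ∈ D → k′ ∈ D′) →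
    (k ∈ D → w k ≡ w′ k′) → Occurs c w D → Occurs c w′ D′
  occurs-point c D⊆ f eq (m , m∈D , cm) with refl ← D⊆ m∈D = _ , f m∈D , subst c (eq m∈D) cm

  occurs-sum : ∀ {Σ} (c : Pred Σ 0ℓ) {w w′ D D′ β β′} →
    (∀ n → Occurs c w ((D , β) ↾ n) → Occurs c w′ ((D′ , β′) ↾ n)) → Occurs c w D → Occurs c w′ D′
  occurs-sum c {β = β} h (k , k∈D , ck) with (k′ , (k′∈D′ , _) , ck′) ← h (β k) (k , (k∈D , refl) , ck) =
    k′ , k′∈D′ , ck′

  occurrence : ∀ {Σ} → Pred Σ 0ℓ → Types Σ
  occurrence c = fromPred 1 (λ _ → Occurs c) (λ _ D⊆ f _ _ → occurs-point c D⊆ f)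
    (λ _ {w} {w′} {D} {D′} {β} {β′} _ _ h _ → occurs-sum c {w} {w′} {D} {D′} {β} {β′} (λ n → h n zero))

  occurrence-reflects : ∀ {Σ} (c : Pred Σ 0ℓ) {w w′ D D′} →
    ty (occurrence c) w D ≡ ty (occurrence c) w′ D′ → Occurs c w D → Occurs c w′ D′
  occurrence-reflects c {w} {w′} {D} {D′} eq =
    code-reflects {1} {λ _ → Occurs c w D} {λ _ → Occurs c w′ D′} eq {zero}

  -- The letters of a pair k < m may lie in two different blocks, so the type must also record
  -- whether `a` and `b` occur at all.
  PrecedencePred : ∀ {Σ} → Pred Σ 0ℓ → Pred Σ 0ℓ → Fin 3 → Word Σ → Pred ℤ 0ℓ → Set
  PrecedencePred a b zero          = Occurs a
  PrecedencePred a b (suc zero)    = Occurs b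
  PrecedencePred a b (suc (suc _)) = Precedes a b

  precedence : ∀ {Σ} → Pred Σ 0ℓ → Pred Σ 0ℓ → Types Σ
  precedence {Σ} a b = fromPred 3 P pt sm
    where
    P = PrecedencePred a b
    pt : ∀ t {w w′ D D′ k k′} → D ⊆ (k ≡_) → (k ∈ D → k′ ∈ D′) → (k′ ∈ D′ → k ∈ D) → D′ ⊆ (k′ ≡_) →
      (k ∈ D → w k ≡ w′ k′) → P t w D → P t w′ D′
    pt zero D⊆ f _ _           = occurs-point a D⊆ f
    pt (suc zero) D⊆ f _ _     = occurs-point b D⊆ f
    pt (suc (suc _)) D⊆ f _ _ _ (k , m , k∈D , m∈D , k<m , _) =
      contradiction k<m (ℤ.<-irrefl (trans (sym (D⊆ k∈D)) (D⊆ m∈D)))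
    sm : ∀ t {w w′ D D′ β β′} → Mono β → Mono β′ →
      (∀ n t → P t w ((D , β) ↾ n) → P t w′ ((D′ , β′) ↾ n)) →
      (∀ n t → P t w′ ((D′ , β′) ↾ n) → P t w ((D , β) ↾ n)) → P t w D → P t w′ D′
    sm zero {w} {w′} {D} {D′} {β} {β′} _ _ h _       = occurs-sum a {w} {w′} {D} {D′} {β} {β′} (λ n → h n zero)
    sm (suc zero) {w} {w′} {D} {D′} {β} {β′} _ _ h _ = occurs-sum b {w} {w′} {D} {D′} {β} {β′} (λ n → h n (suc zero))
    sm (suc (suc _)) {β = β} {β′} β↑ β′↑ h _ (k , m , k∈D , m∈D , k<m , ak , bm) with β k ≟ β m
    ... | yes e with (k′ , m′ , (k′∈D′ , _) , (m′∈D′ , _) , k′<m′ , ak′ , bm′) ←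
                     h (β k) (suc (suc zero)) (k , m , (k∈D , refl) , (m∈D , sym e) , k<m , ak , bm) =
      k′ , m′ , k′∈D′ , m′∈D′ , k′<m′ , ak′ , bm′
    ... | no k≁m with (k′ , (k′∈D′ , ek) , ak′) ← h (β k) zero (k , (k∈D , refl) , ak)
                    | (m′ , (m′∈D′ , em) , bm′) ← h (β m) (suc zero) (m , (m∈D , refl) , bm) =
      k′ , m′ , k′∈D′ , m′∈D′ , k′<m′ , ak′ , bm′
      where
      -- The witnesses lie in the distinct blocks `β k` and `β m`. If m′ ≤ k′, then β m ≤ β k by
      -- monotonicity of `β′`, while k < m gives the converse.
      k′<m′ : k′ < m′
      k′<m′ = ℤ.≰⇒> λ m′≤k′ → k≁m (ℤ.≤-antisym (β↑ (ℤ.<⇒≤ k<m)) (subst₂ _≤_ em ek (β′↑ m′≤k′)))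

  precedence-reflects : ∀ {Σ} (a b : Pred Σ 0ℓ) {w w′ D D′} →
    ty (precedence a b) w D ≡ ty (precedence a b) w′ D′ → Precedes a b w D → Precedes a b w′ D′
  precedence-reflects a b {w} {w′} {D} {D′} eq =
    code-reflects {3} {λ t → PrecedencePred a b t w D} {λ t → PrecedencePred a b t w′ D′} eq {suc (suc zero)}

  product : ∀ {Σ} → Types Σ → Types Σ → Types Σ
  product S T .N = S .N ℕ.* T .N
  product S T .ty w D = combine (S .ty w D) (T .ty w D)
  product S T .point D⊆ D′⊆ f g eq = cong₂ combine (S .point D⊆ D′⊆ f g eq) (T .point D⊆ D′⊆ f g eq)
  product S T .sum β↑ β′↑ eq = cong₂ combine
    (S .sum β↑ β′↑ (λ n → Fin.combine-injectiveˡ _ _ _ _ (eq n)))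
    (T .sum β↑ β′↑ (λ n → Fin.combine-injectiveʳ (S .ty _ _) _ (S .ty _ _) _ (eq n)))

  product-reflects : ∀ {Σ} (S T : Types Σ) {w w′ D D′} → ty (product S T) w D ≡ ty (product S T) w′ D′ →
    ty S w D ≡ ty S w′ D′ × ty T w D ≡ ty T w′ D′
  product-reflects S T {w} {w′} {D} {D′} = Fin.combine-injective (S .ty w D) (T .ty w D) (S .ty w′ D′) (T .ty w′ D′)

  relabel : ∀ {Σ Δ} → (Σ → Δ) → Types Δ → Types Σ
  relabel h T .N = T .N
  relabel h T .ty w = T .ty (h ∘ w)
  relabel h T .point D⊆ D′⊆ f g eq = T .point D⊆ D′⊆ f g (cong h ∘ eq)
  relabel h T .sum = T .sum

  Lift : ∀ {Σ Δ} → (Σ → Δ → Set) → Word Σ → Word Δ → Pred ℤ 0ℓ → Set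
  Lift E w ŵ D = ∀ {k} → k ∈ D → E (w k) (ŵ k)

  LiftType : ∀ {Σ Δ} → (Σ → Δ → Set) → (T : Types Δ) → Fin (T .N) → Word Σ → Pred ℤ 0ℓ → Set
  LiftType E T t w D = ∃[ ŵ ] Lift E w ŵ D × T .ty ŵ D ≡ t

  -- Existential quantification: the new type of a word is the set of `T`-types of its lifts.
  -- Composition survives because `E` is a condition on single letters, so lifts of the blocks can
  -- be chosen independently.
  project : ∀ {Σ Δ} → (Σ → Δ → Set) → Types Δ → Types Σ
  project {Σ} {Δ} E T = fromPred (T .N) P pt sm
    where
    P = LiftType E T
    pt : ∀ t {w w′ D D′ k k′} → D ⊆ (k ≡_) → (k ∈ D → k′ ∈ D′) → (k′ ∈ D′ → k ∈ D) → D′ ⊆ (k′ ≡_) →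
      (k ∈ D → w k ≡ w′ k′) → P t w D → P t w′ D′
    pt t {w} {w′} {D} {D′} {k} {k′} D⊆ f g D′⊆ eq (ŵ , lift , refl) = const (ŵ k) , lift′ ,
      T .point D′⊆ D⊆ g f (λ _ → refl)
      where
      lift′ : Lift E w′ (const (ŵ k)) D′
      lift′ m∈D′ with refl ← D′⊆ m∈D′ = subst (λ a → E a (ŵ k)) (eq (g m∈D′)) (lift (g m∈D′))
    sm : ∀ t {w w′ D D′ β β′} → Mono β → Mono β′ →
      (∀ n t → P t w ((D , β) ↾ n) → P t w′ ((D′ , β′) ↾ n)) →
      (∀ n t → P t w′ ((D′ , β′) ↾ n) → P t w ((D , β) ↾ n)) → P t w D → P t w′ D′
    sm t {w} {w′} {D} {D′} {β} {β′} β↑ β′↑ h _ (ŵ , lift , refl) = glue ,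
      (λ k∈D′ → proj₁ (proj₂ (piece _)) (k∈D′ , refl)) ,
      T .sum β′↑ β↑ (λ n → trans (local T id id λ { (_ , refl) → refl }) (proj₂ (proj₂ (piece n))))
      where
      piece : ∀ n → P (T .ty ŵ ((D , β) ↾ n)) w′ ((D′ , β′) ↾ n)
      piece n = h n _ (ŵ , lift ∘ proj₁ , refl)
      -- Each position takes its letter from the lift chosen for its own block.
      glue : Word Δ
      glue k = proj₁ (piece (β′ k)) k

  project-reflects : ∀ {Σ Δ} {E : Σ → Δ → Set} {T : Types Δ} {w w′ D D′ ŵ} →
    ty (project E T) w D ≡ ty (project E T) w′ D′ → Lift E w ŵ D →
    ∃[ ŵ′ ] Lift E w′ ŵ′ D′ × ty T ŵ′ D′ ≡ ty T ŵ D
  project-reflects {E = E} {T} {w} {w′} {D} {D′} {ŵ} eq lift =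
    code-reflects {P = λ t → LiftType E T t w D} {λ t → LiftType E T t w′ D′} eq (ŵ , lift , refl)

  -- Unlike negation, ν maps the half-open interval [a, b) to the half-open interval [-b, -a).
  ν : ℤ → ℤ
  ν k = -1ℤ - k

  ν-involutive : ∀ k → ν (ν k) ≡ k
  ν-involutive = lemma
    where
    lemma : ∀ k → -1ℤ - (-1ℤ - k) ≡ k
    lemma = solve-∀

  ν-anti : ∀ {k m} → k ≤ m → ν m ≤ ν k
  ν-anti = ℤ.+-monoʳ-≤ -1ℤ ∘ ℤ.neg-mono-≤

  -- Allows left-infinite parts of a word to be treated as right-infinite ones.
  reverse : ∀ {Σ} → Types Σ → Types Σ
  reverse T .N = T .N
  reverse T .ty w D = T .ty (w ∘ ν) (D ∘ ν)
  reverse {Σ} T .point {w} {w′} {D} {D′} {k} {k′} D⊆ D′⊆ f g eq =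
    T .point (swap D⊆) (swap D′⊆) (unfold′ ∘ f ∘ fold) (unfold ∘ g ∘ fold′)
      (λ k∈ → trans (cong w (ν-involutive k)) (trans (eq (fold k∈)) (sym (cong w′ (ν-involutive k′)))))
    where
    swap : ∀ {D : Pred ℤ 0ℓ} {k} → D ⊆ (k ≡_) → D ∘ ν ⊆ (ν k ≡_)
    swap D⊆ {m} m∈ = trans (cong ν (D⊆ m∈)) (ν-involutive m)
    fold : D (ν (ν k)) → D k
    fold = subst D (ν-involutive k)
    unfold : D k → D (ν (ν k))
    unfold = subst D (sym (ν-involutive k))
    fold′ : D′ (ν (ν k′)) → D′ k′
    fold′ = subst D′ (ν-involutive k′)
    unfold′ : D′ k′ → D′ (ν (ν k′))
    unfold′ = subst D′ (sym (ν-involutive k′))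
  reverse {Σ} T .sum {w} {w′} {D} {D′} {β} {β′} β↑ β′↑ eq =
    -- `β ∘ ν` is antitone; negating the block numbers makes it monotone again.
    T .sum (λ k≤m → ℤ.neg-mono-≤ (β↑ (ν-anti k≤m))) (λ k≤m → ℤ.neg-mono-≤ (β′↑ (ν-anti k≤m)))
      λ n → trans (local T (map₂ (flip-sign _ n)) (map₂ (flip-sign′ _ n)) (λ _ → refl))
           (trans (eq (- n)) (local T (map₂ (flip-sign′ _ n)) (map₂ (flip-sign _ n)) (λ _ → refl)))
    where
    flip-sign : ∀ b n → - b ≡ n → b ≡ - n
    flip-sign b n e = trans (sym (ℤ.neg-involutive b)) (cong -_ e)
    flip-sign′ : ∀ b n → b ≡ - n → - b ≡ n
    flip-sign′ b n e = trans (cong -_ e) (ℤ.neg-involutive n)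

  -- Recognisable properties and their closure under the operations of monadic second-order logic.

  -- Position variables are encoded as singleton sets.
  mark : ∀ {Σ n} → Vec ℤ n → Word Σ → Word (Vec Bool n × Σ)
  mark π w k = Vec.map (λ p → does (p ≟ k)) π , w k

  Property : Set → ℕ → Set₁
  Property Σ n = Word Σ → Vec ℤ n → Set

  -- Stands in for definability in monadic second-order logic with n free position variables: the
  -- truth of `Q` depends only on the type of the whole marked word.
  record Recognisable {Σ n} (Q : Property Σ n) : Set₁ where
    field
      types  : Types (Vec Bool n × Σ)
      decide : ∀ {w w′ π π′} → ty types (mark π w) U ≡ ty types (mark π′ w′) U → Q w π → Q w′ π′

  open Recognisable

  rec-resp : ∀ {Σ n} {P Q : Property Σ n} → (∀ {w π} → P w π ⇔ Q w π) → Recognisable P → Recognisable Q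
  rec-resp P⇔Q r .types = r .types
  rec-resp P⇔Q r .decide eq q = to P⇔Q (r .decide eq (from P⇔Q q))

  rec-⊥ : ∀ {Σ n} → Recognisable {Σ} {n} (λ _ _ → ⊥)
  rec-⊥ .types = occurrence (λ _ → ⊥)
  rec-⊥ .decide _ ()

  rec-→ : ∀ {Σ n} {P Q : Property Σ n} → Recognisable P → Recognisable Q → Recognisable (λ w π → P w π → Q w π)
  rec-→ p q .types = product (p .types) (q .types)
  rec-→ p q .decide eq f x with (eqP , eqQ) ← product-reflects (p .types) (q .types) eq =
    q .decide eqQ (f (p .decide (sym eqP) x))

  rec-× : ∀ {Σ n} {P Q : Property Σ n} → Recognisable P → Recognisable Q → Recognisable (λ w π → P w π × Q w π)
  rec-× p q .types = product (p .types) (q .types)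
  rec-× p q .decide eq (x , y) with (eqP , eqQ) ← product-reflects (p .types) (q .types) eq =
    p .decide eqP x , q .decide eqQ y

  rec-¬ : ∀ {Σ n} {P : Property Σ n} → Recognisable P → Recognisable (λ w π → ¬ P w π)
  rec-¬ p = rec-→ p rec-⊥

  ForgetSet : ∀ {Σ n} → Vec Bool n × Σ → Vec Bool n × Bool × Σ → Set
  ForgetSet (b , a) (b̂ , _ , â) = b ≡ b̂ × a ≡ â

  rec-∃-set : ∀ {Σ n} {Q : Property (Bool × Σ) n} → Recognisable Q →
    Recognisable (λ w π → ∃[ X ] Q (λ k → X k , w k) π)
  rec-∃-set q .types = project ForgetSet (q .types)
  rec-∃-set q .decide {w} {w′} {π} {π′} eq (X , holds)
    with (ŵ , lift , e) ← project-reflects {E = ForgetSet} {T = q .types} {ŵ = mark π (λ k → X k , w k)} eq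
                            (λ _ → refl , refl) =
    proj₁ ∘ proj₂ ∘ ŵ , q .decide (trans (sym e) (local (q .types) id id
      (λ {k} _ → cong₂ (λ b a → b , proj₁ (proj₂ (ŵ k)) , a) (sym (proj₁ (lift tt))) (sym (proj₂ (lift tt)))))) holds

  ForgetMark : ∀ {Σ n} → Vec Bool n × Σ → Vec Bool (suc n) × Σ → Set
  ForgetMark (bs , a) (b̂s , â) = bs ≡ tail b̂s × a ≡ â

  Marked : ∀ {Σ : Set} {n} → Vec Bool (suc n) × Σ → Set
  Marked (bs , _) = T (head bs)

  does⇒ : ∀ {P : Set} (P? : Dec P) → T (does P?) → P
  does⇒ (yes p) _ = p

  ⇒does : ∀ {P : Set} (P? : Dec P) → P → T (does P?)
  ⇒does (yes _) _ = tt
  ⇒does (no ¬p) p = contradiction p ¬p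

  does≡ : ∀ {P : Set} {b} (P? : Dec P) → (T b → P) → (P → T b) → does P? ≡ b
  does≡ {b = true}  P? f _ = dec-true P? (f tt)
  does≡ {b = false} P? _ g = dec-false P? g

  singly-marked : ∀ {Σ n} (w : Word (Vec Bool (suc n) × Σ)) → Occurs Marked w U → ¬ Precedes Marked Marked w U →
    ∃[ k ] ∀ m → does (k ≟ m) ≡ head (proj₁ (w m))
  singly-marked w (k , _ , marked) unique = k , λ m → does≡ (k ≟ m) (only m) λ { refl → marked }
    where
    only : ∀ m → w m ∈ Marked → k ≡ m
    only m m-marked with ℤ.<-cmp k m
    ... | tri< k<m _ _ = contradiction (k , m , tt , tt , k<m , marked , m-marked) unique
    ... | tri≈ _ k≡m _ = k≡m
    ... | tri> _ _ m<k = contradiction (m , k , tt , tt , m<k , m-marked , marked) unique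

  no-precedence : ∀ {Σ n} (w : Word Σ) (π : Vec ℤ n) k → ¬ Precedes Marked Marked (mark (k ∷ π) w) U
  no-precedence w π k (m , m′ , _ , _ , m<m′ , m≡k , m′≡k) =
    ℤ.<-irrefl (trans (sym (does⇒ (k ≟ m) m≡k)) (does⇒ (k ≟ m′) m′≡k)) m<m′

  -- A position quantifier is a set quantifier restricted to singletons. A set of marks is a
  -- singleton when some mark occurs and no mark precedes another, so both facts are added to the
  -- types before projecting.
  rec-∃ : ∀ {Σ n} {Q : Property Σ (suc n)} → Recognisable Q → Recognisable (λ w π → ∃[ k ] Q w (k ∷ π))
  rec-∃ q .types = project ForgetMark (product (q .types) (product (occurrence Marked) (precedence Marked Marked)))
  rec-∃ {Σ} {n} {Q} q .decide {w} {w′} {π} {π′} eq (k , holds)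
    with (ŵ , lift , e) ← project-reflects
           {E = ForgetMark} {product (q .types) (product (occurrence Marked) (precedence Marked Marked))}
           {ŵ = mark (k ∷ π) w} eq (λ _ → refl , refl)
    with (e₁ , e′) ← product-reflects (q .types) (product (occurrence Marked) (precedence Marked Marked))
                       {w = ŵ} {mark (k ∷ π) w} {U} {U} e
    with (e₂ , e₃) ← product-reflects (occurrence Marked) (precedence Marked Marked)
                       {w = ŵ} {mark (k ∷ π) w} {U} {U} e′
    with (k′ , at-k′) ← singly-marked ŵ
           (occurrence-reflects Marked {w = mark (k ∷ π) w} {ŵ} (sym e₂) (k , tt , ⇒does (k ≟ k) refl))
           (λ p → no-precedence w π k (precedence-reflects Marked Marked {w = ŵ} {mark (k ∷ π) w} e₃ p)) =
    k′ , q .decide (trans (sym e₁) (local (q .types) id id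
           (λ {m} _ → sym (rebuild (ŵ m) (at-k′ m) (lift tt))))) holds
    where
    rebuild : ∀ {b bs a} (x : Vec Bool (suc n) × Σ) → b ≡ head (proj₁ x) → ForgetMark (bs , a) x → (b ∷ bs , a) ≡ x
    rebuild (_ ∷ _ , _) refl (refl , refl) = refl

  MarkedAt : ∀ {Σ : Set} {n} → Fin n → Pred (Vec Bool n × Σ) 0ℓ
  MarkedAt x (bs , _) = T (lookup bs x)

  marked-self : ∀ {Σ n} (w : Word Σ) (π : Vec ℤ n) x → mark π w (lookup π x) ∈ MarkedAt x
  marked-self w π x = subst T (sym (lookup-map x (λ p → does (p ≟ lookup π x)) π))
    (⇒does (lookup π x ≟ lookup π x) refl)

  marked⇒≡ : ∀ {Σ : Set} {n} (w : Word Σ) (π : Vec ℤ n) x {k} → mark π w k ∈ MarkedAt x → lookup π x ≡ k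
  marked⇒≡ w π x {k} m = does⇒ (lookup π x ≟ k) (subst T (lookup-map x (λ p → does (p ≟ k)) π) m)

  rec-letter : ∀ {Σ n} (c : Pred Σ 0ℓ) (x : Fin n) → Recognisable (λ w π → w (lookup π x) ∈ c)
  rec-letter c x .types = occurrence λ a → a ∈ MarkedAt x × proj₂ a ∈ c
  rec-letter c x .decide {w} {w′} {π} {π′} eq cx
    with (k , _ , k-marked , ck) ← occurrence-reflects (λ a → a ∈ MarkedAt x × proj₂ a ∈ c)
                                     {w = mark π w} {mark π′ w′} eq (lookup π x , tt , marked-self w π x , cx)
    with refl ← marked⇒≡ w′ π′ x k-marked = ck

  rec-< : ∀ {Σ : Set} {n} (x y : Fin n) → Recognisable {Σ} (λ w π → lookup π x < lookup π y)
  rec-< x y .types = precedence (MarkedAt x) (MarkedAt y)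
  rec-< x y .decide {w} {w′} {π} {π′} eq x<y
    with (k , m , _ , _ , k<m , k-marked , m-marked) ←
           precedence-reflects (MarkedAt x) (MarkedAt y) {w = mark π w} {mark π′ w′} eq
             (lookup π x , lookup π y , tt , tt , x<y , marked-self w π x , marked-self w π y)
    with refl ← marked⇒≡ w′ π′ x k-marked | refl ← marked⇒≡ w′ π′ y m-marked = k<m

  rec-≤ : ∀ {Σ n} (x y : Fin n) → Recognisable {Σ} (λ w π → lookup π x ≤ lookup π y)
  rec-≤ x y = rec-resp (mk⇔ ℤ.≮⇒≥ ℤ.≤⇒≯) (rec-¬ (rec-< y x))

  rec-∀ : ∀ {Σ n} {Q : Property Σ (suc n)} → Recognisable Q → Recognisable (λ w π → ∀ k → Q w (k ∷ π))
  rec-∀ q = rec-resp (mk⇔ (λ f k → decidable-stable lem λ ¬q → f (k , ¬q)) (λ f (k , ¬q) → ¬q (f k)))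
    (rec-¬ (rec-∃ (rec-¬ q)))

  rec-∀-set : ∀ {Σ n} {Q : Property (Bool × Σ) n} → Recognisable Q →
    Recognisable (λ w π → ∀ X → Q (λ k → X k , w k) π)
  rec-∀-set q = rec-resp (mk⇔ (λ f X → decidable-stable lem λ ¬q → f (X , ¬q)) (λ f (X , ¬q) → ¬q (f X)))
    (rec-¬ (rec-∃-set (rec-¬ q)))

  rec-⊎ : ∀ {Σ n} {P Q : Property Σ n} → Recognisable P → Recognisable Q → Recognisable (λ w π → (¬ P w π) ⊎ Q w π)
  rec-⊎ p q = rec-resp (mk⇔ →⇒¬⊎ ¬⊎⇒→) (rec-→ p q)

  -- The impredicative form of the closure turns the star into a quantification over sets.
  star⇔closed : ∀ {R : ℤ → ℤ → Set} {i j} →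
    Star R i j ⇔ (∀ (X : ℤ → Bool) → T (X i) → (∀ k m → T (X k) → R k m → T (X m)) → T (X j))
  star⇔closed {R} {i} {j} = mk⇔ (λ s X Xi closed → go X closed s Xi)
    (λ f → does⇒ lem (f (λ k → does (lem {Star R i k})) (⇒does lem ε)
      (λ k m ik km → ⇒does lem (does⇒ lem ik ◅◅ km ◅ ε))))
    where
    go : ∀ (X : ℤ → Bool) → (∀ k m → T (X k) → R k m → T (X m)) → ∀ {i} → Star R i j → T (X i) → T (X j)
    go X closed ε Xi = Xi
    go X closed (r ◅ s) Xi = go X closed s (closed _ _ Xi r)

  -- Satisfaction is recognisable.

  trace : ∀ {V Σ} → (Σ → V → Bool) → Word Σ → Trace V
  trace v w k q = T (v (w k) q)

  i+1≤k⇔i<k : ∀ {i k} → i + 1ℤ ≤ k ⇔ i < k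
  i+1≤k⇔i<k {i} {k} = mk⇔ (λ le → ℤ.suc[i]≤j⇒i<j (subst (_≤ k) (ℤ.+-comm i 1ℤ) le))
    (λ lt → subst (_≤ k) (ℤ.+-comm 1ℤ i) (ℤ.i<j⇒suc[i]≤j lt))

  -- Describes the successor by the order alone, since the order is what is known to be
  -- recognisable.
  successor⇔next : ∀ {i k} → k ≡ i + 1ℤ ⇔ (i < k × ∀ m → i < m → k ≤ m)
  successor⇔next {i} = mk⇔ (λ { refl → to i+1≤k⇔i<k ℤ.≤-refl , λ _ → from i+1≤k⇔i<k })
    (λ (i<k , least) → ℤ.≤-antisym (least (i + 1ℤ) (to i+1≤k⇔i<k ℤ.≤-refl)) (from i+1≤k⇔i<k i<k))

  -- Induction on `A` for all alphabets and readings `v` at once: the case of star quantifies over a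
  -- set, which becomes an extra component of the letters that `v` has to skip.
  satisfaction-recognisable : ∀ {V Σ n} (A : Formula V) (v : Σ → V → Bool) (x y : Fin n) →
    Recognisable {Σ} (λ w π → trace v w [ lookup π x , lookup π y ]⊨ A)
  satisfaction-recognisable ⊥′ v x y = rec-⊥
  satisfaction-recognisable (var q) v x y = rec-letter (λ a → T (v a q)) x
  satisfaction-recognisable (A ⊃ B) v x y =
    rec-⊎ (satisfaction-recognisable A v x y) (satisfaction-recognisable B v x y)
  satisfaction-recognisable (○ A) v x y = rec-resp
    (mk⇔ (λ { (x<y , k , next , h) → x<y , subst (λ k → _ [ k , _ ]⊨ A) (from successor⇔next next) h })
         (λ { (x<y , h) → x<y , _ , to successor⇔next refl , h }))
    (rec-× (rec-< x y) (rec-∃ (rec-×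
      (rec-× (rec-< (suc x) zero) (rec-∀ (rec-→ (rec-< (suc (suc x)) zero) (rec-≤ (suc zero) zero))))
      (satisfaction-recognisable A v zero (suc y)))))
  satisfaction-recognisable (A ⨾ B) v x y = rec-∃ (rec-× (rec-≤ (suc x) zero) (rec-× (rec-≤ zero (suc y))
    (rec-× (satisfaction-recognisable A v (suc x) zero) (satisfaction-recognisable B v zero (suc y)))))
  satisfaction-recognisable (A *) v x y = rec-resp (mk⇔ (from star⇔closed) (to star⇔closed))
    (rec-∀-set (rec-→ (rec-letter (T ∘ proj₁) x)
      (rec-→ (rec-∀ (rec-∀ (rec-→ (rec-letter (T ∘ proj₁) (suc zero))
        (rec-→ (rec-× (rec-< (suc zero) zero) (satisfaction-recognisable A (v ∘ proj₂) (suc zero) zero))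
          (rec-letter (T ∘ proj₁) zero)))))
        (rec-letter (T ∘ proj₁) y))))
  satisfaction-recognisable (◊l A) v x y =
    rec-∃ (rec-× (rec-≤ zero (suc x)) (satisfaction-recognisable A v zero (suc x)))
  satisfaction-recognisable (◊r A) v x y =
    rec-∃ (rec-× (rec-≤ (suc y) zero) (satisfaction-recognisable A v (suc y) zero))

  -- Properties of intervals definable in ITL-NL over a list of variables.

  Λ : Set
  Λ = List Bool

  module Definability {V : Set} (vs : List V) where

    letters : Word (V → Bool) → Word Λ
    letters ρ k = List.map (ρ k) vs

    record Definable (P : Word (V → Bool) → ℤ → ℤ → Set) : Set where
      field
        formula : Formula V
        over    : Var formula ⊆ (_∈ₗ vs)
        defines : ∀ ρ {i j} → i ≤ j → trace id ρ [ i , j ]⊨ formula ⇔ P ρ i j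

    open Definable public

    private variable P Q : Word (V → Bool) → ℤ → ℤ → Set

    def-resp : (∀ {w i j} → i ≤ j → P w i j ⇔ Q w i j) → Definable P → Definable Q
    def-resp P⇔Q d .formula = d .formula
    def-resp P⇔Q d .over = d .over
    def-resp P⇔Q d .defines ρ i≤j = mk⇔
      (to (P⇔Q i≤j) ∘ to (d .defines ρ i≤j))
      (from (d .defines ρ i≤j) ∘ from (P⇔Q i≤j))

    def-⊥ : Definable (λ _ _ _ → ⊥)
    def-⊥ .formula = ⊥′
    def-⊥ .over ()
    def-⊥ .defines ρ _ = mk⇔ id id

    def-→ : Definable P → Definable Q → Definable (λ w i j → P w i j → Q w i j)
    def-→ d e .formula = d .formula ⊃ e .formula
    def-→ d e .over (inj₁ q) = d .over q
    def-→ d e .over (inj₂ q) = e .over q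
    def-→ d e .defines ρ i≤j = mk⇔
      (λ h → to (e .defines ρ i≤j) ∘ ¬⊎⇒→ h ∘ from (d .defines ρ i≤j))
      (λ f → →⇒¬⊎ (from (e .defines ρ i≤j) ∘ f ∘ to (d .defines ρ i≤j)))

    def-¬ : Definable P → Definable (λ w i j → ¬ P w i j)
    def-¬ d = def-→ d def-⊥

    def-∧ : Definable P → Definable Q → Definable (λ w i j → P w i j × Q w i j)
    def-∧ {P} {Q} d e = def-resp (λ _ → mk⇔ conj λ (p , q) f → f p q) (def-¬ (def-→ d (def-¬ e)))
      where
      conj : ∀ {w i j} → ¬ (P w i j → ¬ Q w i j) → P w i j × Q w i j
      conj f = decidable-stable lem (λ ¬p → f λ p → contradiction p ¬p) , decidable-stable lem (λ ¬q → f λ _ → ¬q)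

    def-∨ : Definable P → Definable Q → Definable (λ w i j → P w i j ⊎ Q w i j)
    def-∨ {P} {Q} d e = def-resp (λ _ → mk⇔ disj λ { (inj₁ p) ¬p → contradiction p ¬p ; (inj₂ q) _ → q })
      (def-→ (def-¬ d) e)
      where
      disj : ∀ {w i j} → (¬ P w i j → Q w i j) → P w i j ⊎ Q w i j
      disj {w} {i} {j} f with lem {P w i j}
      ... | yes p = inj₁ p
      ... | no ¬p = inj₂ (f ¬p)

    -- For side conditions that depend on neither word nor interval; excluded middle selects the
    -- formula.
    def-const : ∀ (A : Set) → Definable (λ _ _ _ → A)
    def-const A with lem {A}
    ... | yes a = def-resp (λ _ → mk⇔ (const a) (λ _ ())) (def-¬ def-⊥)
    ... | no ¬a = def-resp (λ _ → mk⇔ (λ ()) ¬a) def-⊥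

    def-∃ : ∀ {N} {P : Fin N → Word (V → Bool) → ℤ → ℤ → Set} → (∀ t → Definable (P t)) →
      Definable (λ w i j → ∃[ t ] P t w i j)
    def-∃ {zero}  d = def-resp (λ _ → mk⇔ (λ ()) (λ ())) def-⊥
    def-∃ {suc N} d = def-resp
      (λ _ → mk⇔ (λ { (inj₁ p) → zero , p ; (inj₂ (t , p)) → suc t , p })
                 (λ { (zero , p) → inj₁ p ; (suc t , p) → inj₂ (t , p) }))
      (def-∨ (d zero) (def-∃ (d ∘ suc)))

    def-○ : Definable P → Definable (λ w i j → i < j × P w (i + 1ℤ) j)
    def-○ d .formula = ○ d .formula
    def-○ d .over = d .over
    def-○ d .defines ρ i≤j = mk⇔ (λ (i<j , p) → i<j , to (d .defines ρ (from i+1≤k⇔i<k i<j)) p)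
      (λ (i<j , p) → i<j , from (d .defines ρ (from i+1≤k⇔i<k i<j)) p)

    def-⨾ : Definable P → Definable Q → Definable (λ w i j → ∃[ k ] i ≤ k × k ≤ j × P w i k × Q w k j)
    def-⨾ d e .formula = d .formula ⨾ e .formula
    def-⨾ d e .over (inj₁ q) = d .over q
    def-⨾ d e .over (inj₂ q) = e .over q
    def-⨾ d e .defines ρ _ = mk⇔
      (λ (k , i≤k , k≤j , p , q) → k , i≤k , k≤j , to (d .defines ρ i≤k) p , to (e .defines ρ k≤j) q)
      (λ (k , i≤k , k≤j , p , q) → k , i≤k , k≤j , from (d .defines ρ i≤k) p , from (e .defines ρ k≤j) q)

    def-* : Definable P → Definable (λ w → Star (λ i j → i < j × P w i j))
    def-* d .formula = d .formula *
    def-* d .over = d .over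
    def-* d .defines ρ _ = mk⇔ (Star.map λ (i<j , p) → i<j , to (d .defines ρ (ℤ.<⇒≤ i<j)) p)
      (Star.map λ (i<j , p) → i<j , from (d .defines ρ (ℤ.<⇒≤ i<j)) p)

    def-◊l : Definable P → Definable (λ w i j → ∃[ k ] k ≤ i × P w k i)
    def-◊l d .formula = ◊l d .formula
    def-◊l d .over = d .over
    def-◊l d .defines ρ _ = mk⇔ (λ (k , k≤i , p) → k , k≤i , to (d .defines ρ k≤i) p)
      (λ (k , k≤i , p) → k , k≤i , from (d .defines ρ k≤i) p)

    def-◊r : Definable P → Definable (λ w i j → ∃[ k ] j ≤ k × P w j k)
    def-◊r d .formula = ◊r d .formula
    def-◊r d .over = d .over
    def-◊r d .defines ρ _ = mk⇔ (λ (k , j≤k , p) → k , j≤k , to (d .defines ρ j≤k) p)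
      (λ (k , j≤k , p) → k , j≤k , from (d .defines ρ j≤k) p)

    def-var : ∀ {q} → q ∈ₗ vs → Definable (λ ρ i _ → T (ρ i q))
    def-var {q} q∈vs .formula = var q
    def-var q∈vs .over refl = q∈vs
    def-var q∈vs .defines ρ _ = mk⇔ id id

    -- A decision tree that queries the variables in `vs` one after another, with a constant at each
    -- leaf.
    def-letter : ∀ (c : Pred Λ 0ℓ) → Definable (λ ρ i _ → letters ρ i ∈ c)
    def-letter = read vs id
      where
      read : ∀ us → (_∈ₗ us) ⊆ (_∈ₗ vs) → (c : Pred Λ 0ℓ) → Definable (λ ρ i _ → List.map (ρ i) us ∈ c)
      read [] _ c = def-const (c [])
      read (q ∷ us) us⊆vs c = def-resp (λ {ρ} {i} _ → case-bit (ρ i q))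
        (def-∨ (def-∧ (def-var (us⊆vs (here refl))) (read us (us⊆vs ∘ there) (c ∘ (true ∷_))))
               (def-∧ (def-¬ (def-var (us⊆vs (here refl)))) (read us (us⊆vs ∘ there) (c ∘ (false ∷_)))))
        where
        case-bit : ∀ b {bs} → ((T b × (true ∷ bs) ∈ c) ⊎ ((¬ T b) × (false ∷ bs) ∈ c)) ⇔ (b ∷ bs) ∈ c
        case-bit true  = mk⇔ (λ { (inj₁ (_ , p)) → p ; (inj₂ (¬t , _)) → contradiction tt ¬t }) (λ p → inj₁ (tt , p))
        case-bit false = mk⇔ (λ { (inj₁ (() , _)) ; (inj₂ (_ , p)) → p }) (λ p → inj₂ (id , p))

    -- An interval from i to j stands for the segment [i, j), which is empty when i = j. This is the
    -- case in which `○` of a true formula fails.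
    def-empty : Definable (λ w i j → i ≡ j)
    def-empty = def-resp (λ i≤j → mk⇔ (λ i≮j → ℤ.≤-antisym i≤j (ℤ.≮⇒≥ λ i<j → i≮j (i<j , tt)))
      (λ { refl (i<i , _) → ℤ.<-irrefl refl i<i })) (def-¬ (def-○ (def-const ⊤)))

  -- Kleene's construction for finite automata.

  i≤j⇒j≡i+n : ∀ {i j} → i ≤ j → ∃[ n ] j ≡ i + pos n
  i≤j⇒j≡i+n {i} {j} i≤j = ℤ.∣ j - i ∣ , sym (trans (cong (i +_) (ℤ.0≤i⇒+∣i∣≡i (ℤ.i≤j⇒0≤j-i i≤j))) (lemma i j))
    where
    lemma : ∀ i j → i + (j - i) ≡ j
    lemma = solve-∀

  module Automaton {N : ℕ} (step : Fin N → Λ → Fin N) where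

    run : Word Λ → ℤ → ℕ → Fin N → Fin N
    run w i zero s    = s
    run w i (suc n) s = step (run w i n s) (w (i + pos n))

    run-+ : ∀ w i m n s → run w i (m ℕ.+ n) s ≡ run w (i + pos m) n (run w i m s)
    run-+ w i m zero s = cong (λ m → run w i m s) (ℕ.+-identityʳ m)
    run-+ w i m (suc n) s = trans (cong (λ m → run w i m s) (ℕ.+-suc m n))
      (cong₂ step (run-+ w i m n s) (cong w (sym (ℤ.+-assoc i (pos m) (pos n)))))

    -- Kleene's auxiliary languages: the intermediate states, with both end states left out, are
    -- confined to `K`.
    record Run (K : List (Fin N)) (s s′ : Fin N) (w : Word Λ) (i : ℤ) (n : ℕ) : Set where
      constructor _,_
      field
        final  : run w i n s ≡ s′
        within : ∀ m → 0 ℕ.< m → m ℕ.< n → run w i m s ∈ₗ K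

    Path : List (Fin N) → Fin N → Fin N → Word Λ → ℤ → ℤ → Set
    Path K s s′ w i j = ∃[ n ] j ≡ i + pos n × Run K s s′ w i n

    path-≤ : ∀ {K s s′ w i j} → Path K s s′ w i j → i ≤ j
    path-≤ {i = i} (n , refl , _) = ℤ.i≤i+j i (pos n)

    weaken : ∀ {K κ s s′ w i j} → Path K s s′ w i j → Path (κ ∷ K) s s′ w i j
    weaken (n , e , final , within) = n , e , final , λ m 0<m m<n → there (within m 0<m m<n)

    join : ∀ {K κ s s′ w i k j} → Path (κ ∷ K) s κ w i k → Path (κ ∷ K) κ s′ w k j → Path (κ ∷ K) s s′ w i j
    join {K} {κ} {s} {s′} {w} {i} (m , refl , final , within) (n , refl , final′ , within′) =
      m ℕ.+ n , ℤ.+-assoc i (pos m) (pos n) , trans (split n) final′ , inner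
      where
      split : ∀ n → run w i (m ℕ.+ n) s ≡ run w (i + pos m) n κ
      split n = trans (run-+ w i m n s) (cong (run w (i + pos m) n) final)
      inner : ∀ o → 0 ℕ.< o → o ℕ.< m ℕ.+ n → run w i o s ∈ₗ (κ ∷ K)
      inner o 0<o o<m+n with ℕ.<-cmp o m
      ... | tri< o<m _ _ = within o 0<o o<m
      ... | tri≈ _ refl _ = here final
      ... | tri> _ _ m<o with (p , refl) ← ℕ.m≤n⇒∃[o]m+o≡n (ℕ.<⇒≤ m<o) =
        subst (_∈ₗ (κ ∷ K)) (sym (split p)) (within′ p (0<p m<o) (ℕ.+-cancelˡ-< m p n o<m+n))
        where
        0<p : ∀ {p} → m ℕ.< m ℕ.+ p → 0 ℕ.< p
        0<p {p} lt = ℕ.+-cancelˡ-< m 0 p (subst (ℕ._< m ℕ.+ p) (sym (ℕ.+-identityʳ m)) lt)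

    Loop : List (Fin N) → Fin N → Word Λ → ℤ → ℤ → Set
    Loop K κ w = Star (λ i j → i < j × Path K κ κ w i j)

    loop-≤ : ∀ {K κ w i j} → Loop K κ w i j → i ≤ j
    loop-≤ ε = ℤ.≤-refl
    loop-≤ ((i<k , _) ◅ l) = ℤ.≤-trans (ℤ.<⇒≤ i<k) (loop-≤ l)

    loop-path : ∀ {K κ w i j} → Loop K κ w i j → Path (κ ∷ K) κ κ w i j
    loop-path {i = i} ε = 0 , sym (ℤ.+-identityʳ i) , refl , λ _ _ ()
    loop-path ((_ , p) ◅ l) = join (weaken p) (loop-path l)

    Decomposition : List (Fin N) → Fin N → Fin N → Fin N → Word Λ → ℤ → ℤ → Set
    Decomposition K κ s s′ w i j = Path K s s′ w i j ⊎
      ∃₂ λ a b → Path K s κ w i a × Loop K κ w a b × Path K κ s′ w b j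

    -- Induction on `bound`: a run with an intermediate visit to `κ` is cut there into two strictly
    -- shorter runs, and their decompositions are glued.
    decompose : ∀ {K κ w} bound n {s s′ i} → n ℕ.< bound → Run (κ ∷ K) s s′ w i n →
      Decomposition K κ s s′ w i (i + pos n)
    decompose {K} {κ} {w} (suc bound) n {s} {s′} {i} (s≤s n≤bound) (final , within)
      with lem {∃[ m ] 0 ℕ.< m × m ℕ.< n × run w i m s ≡ κ}
    ... | no avoid = inj₁ (n , refl , final , λ m 0<m m<n → drop m 0<m m<n (within m 0<m m<n))
      where
      drop : ∀ m → 0 ℕ.< m → m ℕ.< n → run w i m s ∈ₗ (κ ∷ K) → run w i m s ∈ₗ K
      drop m 0<m m<n (here e)  = contradiction (m , 0<m , m<n , e) avoid
      drop m 0<m m<n (there p) = p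
    ... | yes (m , 0<m , m<n , e) with (o , refl) ← ℕ.m≤n⇒∃[o]m+o≡n (ℕ.<⇒≤ m<n) = inj₂ (glue before after)
      where
      after : Decomposition K κ κ s′ w (i + pos m) (i + pos (m ℕ.+ o))
      after = subst (Decomposition K κ κ s′ w (i + pos m)) (ℤ.+-assoc i (pos m) (pos o))
        (decompose bound o (ℕ.<-≤-trans (ℕ.m<n+m o 0<m) n≤bound)
          (trans (cong (run w (i + pos m) o) (sym e)) (trans (sym (run-+ w i m o s)) final) ,
           λ p 0<p p<o → subst (_∈ₗ (κ ∷ K)) (trans (run-+ w i m p s) (cong (run w (i + pos m) p) e))
             (within (m ℕ.+ p) (ℕ.<-≤-trans 0<m (ℕ.m≤m+n m p)) (ℕ.+-monoʳ-< m p<o))))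
      before : Decomposition K κ s κ w i (i + pos m)
      before = decompose bound m (ℕ.<-≤-trans m<n n≤bound) (e , λ p 0<p p<m → within p 0<p (ℕ.<-trans p<m m<n))
      -- The links of a `Loop` must be nonempty, so a path of length 0 is dropped instead of
      -- appended.
      close : ∀ {a b c} → Loop K κ w a b → Path K κ κ w b c → Loop K κ w a c
      close {a} {b} {c} l p with b ≟ c
      ... | yes refl = l
      ... | no b≢c   = l ◅◅ ((ℤ.≤∧≢⇒< (path-≤ p) b≢c , p) ◅ ε)
      glue : ∀ {k j} → Decomposition K κ s κ w i k → Decomposition K κ κ s′ w k j →
             ∃₂ λ a b → Path K s κ w i a × Loop K κ w a b × Path K κ s′ w b j
      glue (inj₁ p) (inj₁ q) = _ , _ , p , ε , q
      glue (inj₁ p) (inj₂ (_ , _ , p′ , l , q)) = _ , _ , p , close ε p′ ◅◅ l , q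
      glue (inj₂ (_ , _ , p , l , q)) (inj₁ q′) = _ , _ , p , close l q , q′
      glue (inj₂ (_ , _ , p , l , q)) (inj₂ (_ , _ , p′ , l′ , q′)) = _ , _ , p , close l q ◅◅ close ε p′ ◅◅ l′ , q′

    -- Kleene's recursion: either `κ` is avoided, or the run goes to `κ`, loops there, and leaves.
    -- The order constraints give it the shape of two nested chops.
    path-∷ : ∀ {K κ s s′ w i j} →
      (Path K s s′ w i j ⊎ ∃[ a ] i ≤ a × a ≤ j × Path K s κ w i a ×
        ∃[ b ] a ≤ b × b ≤ j × Loop K κ w a b × Path K κ s′ w b j) ⇔ Path (κ ∷ K) s s′ w i j
    path-∷ = mk⇔
      (λ { (inj₁ p) → weaken p
         ; (inj₂ (_ , _ , _ , p , _ , _ , _ , l , q)) → join (weaken p) (join (loop-path l) (weaken q)) })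
      λ (n , e , r) → order (subst (Decomposition _ _ _ _ _ _) (sym e) (decompose (suc n) n ℕ.≤-refl r))
      where
      order : ∀ {K κ s s′ w i j} → Decomposition K κ s s′ w i j →
        Path K s s′ w i j ⊎ ∃[ a ] i ≤ a × a ≤ j × Path K s κ w i a ×
          ∃[ b ] a ≤ b × b ≤ j × Loop K κ w a b × Path K κ s′ w b j
      order (inj₁ p) = inj₁ p
      order (inj₂ (a , b , p , l , q)) =
        inj₂ (a , path-≤ p , ℤ.≤-trans (loop-≤ l) (path-≤ q) , p , b , loop-≤ l , path-≤ q , l , q)

    -- Without intermediate states a run has length 0 or 1, as the state after the first step of a
    -- longer run would be one.
    path-[] : ∀ {s s′ w i j} →
      ((i ≡ j × s ≡ s′) ⊎ ((i < j × i + 1ℤ ≡ j) × step s (w i) ≡ s′)) ⇔ Path [] s s′ w i j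
    path-[] {s} {s′} {w} {i} = mk⇔
      (λ { (inj₁ (refl , e)) → 0 , sym (ℤ.+-identityʳ i) , e , λ _ _ ()
         ; (inj₂ ((_ , refl) , e)) → 1 , refl , trans (cong (step s ∘ w) (ℤ.+-identityʳ i)) e ,
             λ { (suc _) _ (s≤s ()) } })
      λ { (0 , refl , e , _) → inj₁ (sym (ℤ.+-identityʳ i) , e)
        ; (1 , refl , e , _) → inj₂ ((to i+1≤k⇔i<k ℤ.≤-refl , refl) , trans (cong (step s ∘ w) (sym (ℤ.+-identityʳ i))) e)
        ; (suc (suc n) , refl , _ , within) → contradiction (within 1 (s≤s z≤n) (s≤s (s≤s z≤n))) λ () }

    module _ {V : Set} (vs : List V) where
      open Definability vs

      def-path : ∀ K s s′ → Definable (λ ρ → Path K s s′ (letters ρ))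
      def-path [] s s′ = def-resp (λ _ → path-[])
        (def-∨ (def-∧ def-empty (def-const (s ≡ s′))) (def-∧ (def-○ def-empty) (def-letter λ a → step s a ≡ s′)))
      def-path (κ ∷ K) s s′ = def-resp (λ _ → path-∷)
        (def-∨ (def-path K s s′) (def-⨾ (def-path K s κ) (def-⨾ (def-* (def-path K κ κ)) (def-path K κ s′))))

      def-run : ∀ s s′ → Definable (λ ρ i j → ∃[ n ] j ≡ i + pos n × run (letters ρ) i n s ≡ s′)
      def-run s s′ = def-resp {P = λ ρ → Path (allFin N) s s′ (letters ρ)}
        (λ _ → mk⇔ (λ (n , e , final , _) → n , e , final) (λ (n , e , final) → n , e , final , λ _ _ _ → ∈-allFin _))
        (def-path (allFin N) s s′)

  -- Types of finite segments are definable.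

  ⟦_,_⟩ : ℤ → ℤ → Pred ℤ 0ℓ
  ⟦ i , j ⟩ k = i ≤ k × k < j

  module Segments {Σ : Set} (T : Types Σ) where

    private M = T .N

    t : Word Σ → ℤ → ℤ → Fin M
    t w i j = ty T w ⟦ i , j ⟩

    t-join : ∀ {w w′ i k j i′ k′ j′} → i ≤ k → k ≤ j → i′ ≤ k′ → k′ ≤ j′ →
      t w i k ≡ t w′ i′ k′ → t w k j ≡ t w′ k′ j′ → t w i j ≡ t w′ i′ j′
    t-join {w} {w′} {i} {k} {j} {i′} {k′} {j′} i≤k k≤j i′≤k′ k′≤j′ lo hi = cut T k k′
      (trans (sym (lower i≤k k≤j)) (trans lo (lower i′≤k′ k′≤j′)))
      (trans (sym (upper i≤k k≤j)) (trans hi (upper i′≤k′ k′≤j′)))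
      where
      lower : ∀ {w i k j} → i ≤ k → k ≤ j → t w i k ≡ ty T w (⟦ i , j ⟩ ∩ (_< k))
      lower i≤k k≤j = local T (λ (i≤m , m<k) → (i≤m , ℤ.<-≤-trans m<k k≤j) , m<k)
        (λ ((i≤m , _) , m<k) → i≤m , m<k) (λ _ → refl)
      upper : ∀ {w i k j} → i ≤ k → k ≤ j → t w k j ≡ ty T w (⟦ i , j ⟩ ∩ (k ≤_))
      upper i≤k k≤j = local T (λ (k≤m , m<j) → (ℤ.≤-trans i≤k k≤m , m<j) , k≤m)
        (λ ((_ , m<j) , k≤m) → k≤m , m<j) (λ _ → refl)

    Factorisation : Fin M → Fin M → Set
    Factorisation x y = ∃₂ λ w i → ∃₂ λ k j → i ≤ k × k ≤ j × t w i k ≡ x × t w k j ≡ y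

    -- The value is irrelevant unless x and y are the types of two adjacent segments of some word.
    mul : Fin M → Fin M → Fin M
    mul x y with lem {Factorisation x y}
    ... | yes (w , i , _ , j , _) = t w i j
    ... | no _ = x

    -- By `t-join`, every factorisation with the same two types yields the value that `mul` took
    -- from one of them.
    t-mul : ∀ {w i k j} → i ≤ k → k ≤ j → t w i j ≡ mul (t w i k) (t w k j)
    t-mul {w} {i} {k} {j} i≤k k≤j with lem {Factorisation (t w i k) (t w k j)}
    ... | yes (w′ , i′ , k′ , j′ , i′≤k′ , k′≤j′ , e₁ , e₂) = t-join i≤k k≤j i′≤k′ k′≤j′ (sym e₁) (sym e₂)
    ... | no none = contradiction (w , i , k , j , i≤k , k≤j , refl , refl) none

  module RegularSegments (T : Types Λ) where

    open Segments T

    private M = T .N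

    unit : Fin M
    unit = ty T (const []) (λ _ → ⊥)

    letter-type : Λ → Fin M
    letter-type a = ty T (const a) (0ℤ ≡_)

    open Automaton (λ s a → mul s (letter-type a))

    t-letter : ∀ w i → t w i (i + 1ℤ) ≡ letter-type (w i)
    t-letter w i = point T {k = i} {0ℤ} (λ (i≤m , m<i+1) → ℤ.≤-antisym i≤m (below m<i+1)) id
      (λ _ → refl) (λ _ → ℤ.≤-refl , to i+1≤k⇔i<k ℤ.≤-refl) (λ _ → refl)
      where
      below : ∀ {m} → m < i + 1ℤ → m ≤ i
      below {m} m<i+1 = ℤ.≮⇒≥ λ i<m → ℤ.<-irrefl refl (ℤ.<-≤-trans m<i+1 (from i+1≤k⇔i<k i<m))

    -- The types are the states of the automaton; reading a letter multiplies by its type on the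
    -- right.
    t-run : ∀ w i n → t w i (i + pos n) ≡ run w i n unit
    t-run w i zero = point T {k = 0ℤ} {0ℤ} (⊥-elim ∘ void) (λ ()) void (λ ()) (⊥-elim ∘ void)
      where
      void : ∀ {k} → ¬ (i ≤ k × k < i + 0ℤ)
      void (i≤k , k<i) = ℤ.<-irrefl refl (ℤ.<-≤-trans (subst (_ <_) (ℤ.+-identityʳ i) k<i) i≤k)
    t-run w i (suc n) = trans
      (cong (t w i) (shift-by i n))
      (trans (t-mul (ℤ.i≤i+j i (pos n)) (ℤ.i≤i+j (i + pos n) 1ℤ))
        (cong₂ mul (t-run w i n) (t-letter w (i + pos n))))
      where
      shift-by : ∀ i n → i + pos (suc n) ≡ i + pos n + 1ℤ
      shift-by i n = trans (cong (λ n → i + pos n) (sym (ℕ.+-comm n 1))) (sym (ℤ.+-assoc i (pos n) 1ℤ))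

    module _ {V : Set} (vs : List V) where
      open Definability vs

      def-t : ∀ x → Definable (λ ρ i j → t (letters ρ) i j ≡ x)
      def-t x = def-resp {P = λ ρ i j → ∃[ n ] j ≡ i + pos n × run (letters ρ) i n unit ≡ x}
        (λ i≤j → mk⇔ (λ { (n , refl , e) → trans (t-run _ _ n) e })
          (λ e → let (n , j≡) = i≤j⇒j≡i+n i≤j in n , j≡ , trans (sym (t-run _ _ n)) (trans (cong (t _ _) (sym j≡)) e)))
        (def-run vs unit x)

  -- Ramsey's theorem for additive colourings.

  Infinitely : Pred ℕ 0ℓ → Set
  Infinitely P = ∀ m → ∃[ n ] m ℕ.≤ n × P n

  ¬infinitely : ∀ {P} → ¬ Infinitely P → ∃[ m ] ∀ n → m ℕ.≤ n → ¬ P n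
  ¬infinitely ¬inf = decidable-stable lem λ ¬bound → ¬inf λ m → decidable-stable lem λ ¬later →
    ¬bound (m , λ n m≤n p → ¬later (n , m≤n , p))

  uniform-bound : ∀ {N} {P : Fin N → Pred ℕ 0ℓ} → (∀ e → ∃[ m ] ∀ n → m ℕ.≤ n → P e n) →
    ∃[ m ] ∀ n → m ℕ.≤ n → ∀ e → P e n
  uniform-bound {zero} h = 0 , λ _ _ ()
  uniform-bound {suc N} h with (m , p) ← h zero | (m′ , p′) ← uniform-bound (h ∘ suc) =
    m ℕ.⊔ m′ , λ { n le zero → p n (ℕ.≤-trans (ℕ.m≤m⊔n m m′) le)
                 ; n le (suc e) → p′ n (ℕ.≤-trans (ℕ.m≤n⊔m m m′) le) e }

  -- Otherwise each colour stops occurring on `P` from some bound on, and beyond a common bound `P`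
  -- would have no members.
  infinite-pigeonhole : ∀ {N P} (c : ℕ → Fin N) → Infinitely P → ∃[ e ] Infinitely (λ n → P n × c n ≡ e)
  infinite-pigeonhole c inf = decidable-stable lem λ none →
    let (m , finite) = uniform-bound (λ e → ¬infinitely (λ inf → none (e , inf)))
        (n , m≤n , p) = inf m
    in finite n m≤n (c n) (p , refl)

  module Ramsey {N : ℕ} (f : ℕ → ℕ → Fin N)
    (propagate : ∀ {k l m n} → k ℕ.≤ m → l ℕ.≤ m → m ℕ.≤ n → f k m ≡ f l m → f k n ≡ f l n) where

    -- By `propagate`, once the colours from k and from l agree at some m, they agree at every later
    -- point.
    Merge : ℕ → ℕ → Set
    Merge k l = ∃[ m ] k ℕ.≤ m × l ℕ.≤ m × f k m ≡ f l m

    -- Otherwise there are N + 1 points no two of which merge, contradicting the pigeonhole principle.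
    merging-point : ∃[ k ] Infinitely (Merge k)
    merging-point = decidable-stable lem λ none →
      let separate k = ¬infinitely (λ inf → none (k , inf)) in contra (proj₁ ∘ separate) (proj₂ ∘ separate)
      where
      contra : (bound : ℕ → ℕ) → ¬ (∀ k n → bound k ℕ.≤ n → ¬ Merge k n)
      contra bound separated = refute (Fin.pigeonhole (ℕ.n<1+n N) (λ a → f (c (toℕ a)) (c N)))
        where
        -- Each point lies past the bound beyond which nothing merges with its predecessor. Two
        -- equal colours at the last point `c N` would be a merge.
        c : ℕ → ℕ
        c zero    = 0
        c (suc a) = c a ℕ.+ bound (c a)
        c-mono : ∀ {a b} → a ℕ.≤ b → c a ℕ.≤ c b
        c-mono {b = zero} z≤n = ℕ.≤-refl
        c-mono {a} {suc b} a≤1+b with ℕ.m≤n⇒m<n∨m≡n a≤1+b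
        ... | inj₁ (s≤s a≤b) = ℕ.≤-trans (c-mono a≤b) (ℕ.m≤m+n _ _)
        ... | inj₂ refl      = ℕ.≤-refl
        refute : ¬ ∃₂ λ (a b : Fin (suc N)) → toℕ a ℕ.< toℕ b × f (c (toℕ a)) (c N) ≡ f (c (toℕ b)) (c N)
        refute (a , b , a<b , e) = separated (c (toℕ a)) (c (toℕ b)) (ℕ.≤-trans (ℕ.m≤n+m _ _) (c-mono a<b))
          (c N , c-mono (ℕ.≤-pred (Fin.toℕ<n a)) , c-mono (ℕ.≤-pred (Fin.toℕ<n b)) , e)

    abstract
      -- Here e is a colour of `f k n` for infinitely many n that merge with k. If k and n agree at
      -- q, then any p beyond n and q with `f k p ≡ e` also has `f n p ≡ e`.
      homogeneous : ∃₂ λ k e → ∀ m → ∃[ n ] m ℕ.≤ n × f k n ≡ e × ∃[ p ] n ℕ.< p × f n p ≡ e × f k p ≡ e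
      homogeneous with (k , merges) ← merging-point
                  with (e , inf) ← infinite-pigeonhole (f k) merges = k , e , later
        where
        later : ∀ m → ∃[ n ] m ℕ.≤ n × f k n ≡ e × ∃[ p ] n ℕ.< p × f n p ≡ e × f k p ≡ e
        later m with (n , m≤n , (q , k≤q , n≤q , fkq≡fnq) , fkn≡e) ← inf m
                with (p , le , _ , fkp≡e) ← inf (suc n ℕ.⊔ q) =
          n , m≤n , fkn≡e , p , ℕ.≤-trans (ℕ.m≤m⊔n (suc n) q) le ,
          trans (sym (propagate k≤q n≤q (ℕ.≤-trans (ℕ.m≤n⊔m (suc n) q) le) fkq≡fnq)) fkp≡e , fkp≡e

  -- Types of right-infinite parts.

  -- Expresses that [j , ∞) splits into a block of type s followed by infinitely many blocks of type e,
  -- without mentioning an infinite sequence.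
  RightTail : ∀ {N} → (ℤ → ℤ → Fin N) → ℤ → Fin N → Fin N → Set
  RightTail f j s e = ∃[ k ] j ≤ k × f j k ≡ s ×
    ∀ m → k ≤ m → ∃[ n ] m ≤ n × f k n ≡ e × ∃[ p ] n < p × f n p ≡ e × f k p ≡ e

  LeftTail : ∀ {N} → (ℤ → ℤ → Fin N) → ℤ → Fin N → Fin N → Set
  LeftTail f i s e = ∃[ k ] k ≤ i × f k i ≡ s ×
    ∀ m → m ≤ k → ∃[ n ] n ≤ m × f n k ≡ e × ∃[ p ] p < n × f p n ≡ e × f p k ≡ e

  pos-mono-≤ : ∀ j {m n} → m ℕ.≤ n → j + pos m ≤ j + pos n
  pos-mono-≤ j m≤n = ℤ.+-monoʳ-≤ j (ℤ.+≤+ m≤n)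

  clip : ℤ → ℕ
  clip (pos n)  = n
  clip -[1+ _ ] = 0

  clip-mono : ∀ {i j} → i ≤ j → clip i ℕ.≤ clip j
  clip-mono (ℤ.+≤+ m≤n) = m≤n
  clip-mono (ℤ.-≤- _)   = z≤n
  clip-mono ℤ.-≤+       = z≤n

  module Tails {Σ : Set} (T : Types Σ) where

    open Segments T

    abstract
      -- Ramsey's theorem for the colouring of a ≤ b by the type of [j + a, j + b); `t-join`
      -- supplies `propagate`.
      right-tail-exists : ∀ w j → ∃₂ (RightTail (t w) j)
      right-tail-exists w j = extend (Ramsey.homogeneous f propagate)
        where
        f : ℕ → ℕ → Fin (T .N)
        f a b = t w (j + pos a) (j + pos b)
        propagate : ∀ {k l m n} → k ℕ.≤ m → l ℕ.≤ m → m ℕ.≤ n → f k m ≡ f l m → f k n ≡ f l n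
        propagate k≤m l≤m m≤n eq =
          t-join (pos-mono-≤ j k≤m) (pos-mono-≤ j m≤n) (pos-mono-≤ j l≤m) (pos-mono-≤ j m≤n) eq refl
        Homogeneous : ℕ → Fin (T .N) → Set
        Homogeneous k e = ∀ m → ∃[ n ] m ℕ.≤ n × f k n ≡ e × ∃[ p ] n ℕ.< p × f n p ≡ e × f k p ≡ e
        later : ∀ {k e} → Homogeneous k e → ∀ m → j + pos k ≤ m → ∃[ n ] m ≤ n × t w (j + pos k) n ≡ e ×
          ∃[ p ] n < p × t w n p ≡ e × t w (j + pos k) p ≡ e
        later {k} recurs m k≤m =
          let (m′ , m≡) = i≤j⇒j≡i+n (ℤ.≤-trans (ℤ.i≤i+j j (pos k)) k≤m)
              (n , m′≤n , e₁ , p , n<p , e₂ , e₃) = recurs m′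
          in j + pos n , subst (_≤ j + pos n) (sym m≡) (pos-mono-≤ j m′≤n) , e₁ ,
             j + pos p , ℤ.+-monoʳ-< j (ℤ.+<+ n<p) , e₂ , e₃
        extend : ∃₂ Homogeneous → ∃₂ (RightTail (t w) j)
        extend (k , e , recurs) = t w j (j + pos k) , e , j + pos k , ℤ.i≤i+j j (pos k) , refl , later recurs

    record Chain (w : Word Σ) (k : ℤ) (e : Fin (T .N)) : Set where
      field
        c      : ℕ → ℤ
        start  : c 0 ≡ k
        ascend : ∀ n → c n < c (suc n)
        link   : ∀ n → t w (c n) (c (suc n)) ≡ e

      ascend-≤ : ∀ {m n} → m ℕ.≤ n → c m ≤ c n
      ascend-≤ {n = zero} z≤n = ℤ.≤-refl
      ascend-≤ {m} {suc n} m≤1+n with ℕ.m≤n⇒m<n∨m≡n m≤1+n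
      ... | inj₁ (s≤s m≤n) = ℤ.≤-trans (ascend-≤ m≤n) (ℤ.<⇒≤ (ascend n))
      ... | inj₂ refl      = ℤ.≤-refl

      -- The number of the link containing `c 0 + d`. As the cut points increase strictly, one step
      -- to the right passes at most one of them.
      index : ℕ → ℕ
      index zero = 0
      index (suc d) with c (suc (index d)) ≤? c 0 + pos (suc d)
      ... | yes _ = suc (index d)
      ... | no _  = index d

      index-step : ∀ d → index d ℕ.≤ index (suc d)
      index-step d with c (suc (index d)) ≤? c 0 + pos (suc d)
      ... | yes _ = ℕ.n≤1+n _
      ... | no _  = ℕ.≤-refl

      index-mono : ∀ {d d′} → d ℕ.≤ d′ → index d ℕ.≤ index d′
      index-mono {d′ = zero} z≤n = ℕ.≤-refl
      index-mono {d} {suc d′} d≤1+d′ with ℕ.m≤n⇒m<n∨m≡n d≤1+d′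
      ... | inj₁ (s≤s d≤d′) = ℕ.≤-trans (index-mono d≤d′) (index-step d′)
      ... | inj₂ refl       = ℕ.≤-refl

      index-link : ∀ d → c 0 + pos d ∈ ⟦ c (index d) , c (suc (index d)) ⟩
      index-link zero = ℤ.≤-reflexive (sym (ℤ.+-identityʳ (c 0))) ,
        subst (_< c 1) (sym (ℤ.+-identityʳ (c 0))) (ascend 0)
      index-link (suc d) with c (suc (index d)) ≤? c 0 + pos (suc d)
      ... | yes le = le , ℤ.≤-<-trans
              (subst (_≤ c (suc (index d))) (trans (ℤ.+-assoc (c 0) (pos d) 1ℤ) (cong (λ n → c 0 + pos n) (ℕ.+-comm d 1)))
                (from i+1≤k⇔i<k (proj₂ (index-link d))))
              (ascend (suc (index d)))
      ... | no ≰ = ℤ.≤-trans (proj₁ (index-link d)) (pos-mono-≤ (c 0) (ℕ.n≤1+n d)) , ℤ.≰⇒> ≰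

      index-unique : ∀ {k m n} → k ∈ ⟦ c m , c (suc m) ⟩ → k ∈ ⟦ c n , c (suc n) ⟩ → m ℕ.≤ n
      index-unique (cm≤k , _) (_ , k<c1+n) = ℕ.≮⇒≥ λ n<m →
        ℤ.<-irrefl refl (ℤ.<-≤-trans k<c1+n (ℤ.≤-trans (ascend-≤ n<m) cm≤k))

      -- The monotone map needed for `sum`. Positions before `c 0` are also sent to 0, but the
      -- domain `c 0 ≤_` excludes them.
      block : ℤ → ℤ
      block k = pos (index (clip (k - c 0)))

      block-mono : Mono block
      block-mono k≤m = ℤ.+≤+ (index-mono (clip-mono (ℤ.+-monoˡ-≤ (- c 0) k≤m)))

      block-link : ∀ {k} → c 0 ≤ k → k ∈ ⟦ c (index (clip (k - c 0))) , c (suc (index (clip (k - c 0)))) ⟩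
      block-link {k} c0≤k with (d , refl) ← i≤j⇒j≡i+n c0≤k =
        subst (λ x → c 0 + pos d ∈ ⟦ c (index (clip x)) , c (suc (index (clip x))) ⟩) (cancel (c 0) (pos d)) (index-link d)
        where
        cancel : ∀ i n → n ≡ i + n - i
        cancel = solve-∀

      block⊆link : ∀ n → ((c 0 ≤_) , block) ↾ pos n ⊆ ⟦ c n , c (suc n) ⟩
      block⊆link n (c0≤k , refl) = block-link c0≤k

      link⊆block : ∀ n → ⟦ c n , c (suc n) ⟩ ⊆ ((c 0 ≤_) , block) ↾ pos n
      link⊆block n {k} (cn≤k , k<) = c0≤k , cong pos (ℕ.≤-antisym
        (index-unique (block-link c0≤k) (cn≤k , k<)) (index-unique (cn≤k , k<) (block-link c0≤k)))
        where c0≤k = ℤ.≤-trans (ascend-≤ z≤n) cn≤k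

      block-type : ∀ n → ty T w (((c 0 ≤_) , block) ↾ pos n) ≡ e
      block-type n = trans (local T (block⊆link n) (link⊆block n) (λ _ → refl)) (link n)

    -- Blocks with natural numbers have type e on both sides and those with negative numbers are
    -- empty, so `sum` applies.
    chain-determines : ∀ {w w′ k k′ e} → Chain w k e → Chain w′ k′ e → ty T w (k ≤_) ≡ ty T w′ (k′ ≤_)
    chain-determines {w} {w′} C C′ = subst₂ (λ k k′ → ty T w (k ≤_) ≡ ty T w′ (k′ ≤_)) (Chain.start C) (Chain.start C′)
      (sum T (Chain.block-mono C) (Chain.block-mono C′) same)
      where
      same : ∀ n → ty T w (((Chain.c C 0 ≤_) , Chain.block C) ↾ n) ≡ ty T w′ (((Chain.c C′ 0 ≤_) , Chain.block C′) ↾ n)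
      same (pos n)  = trans (Chain.block-type C n) (sym (Chain.block-type C′ n))
      same -[1+ n ] = point T {k = 0ℤ} {0ℤ} (λ ()) (λ ()) (λ ()) (λ ()) (λ ())

    -- Each stage keeps a p with [n, p) and [k, p) both of type e, and the next cut point n′ is
    -- taken at or after p. Then [n, n′) has the same type as [k, n′), which is e.
    chain : ∀ {w k e} → (∀ m → k ≤ m → ∃[ n ] m ≤ n × t w k n ≡ e × ∃[ p ] n < p × t w n p ≡ e × t w k p ≡ e) →
      Chain w k e
    chain {w} {k} {e} recurs = record { c = c ; start = refl ; ascend = ascend ; link = link }
      where
      Stage : Set
      Stage = ∃[ n ] k < n × t w k n ≡ e × ∃[ p ] n < p × t w n p ≡ e × t w k p ≡ e
      next : ∀ m → k < m → Stage
      next m k<m = let (n , m≤n , rest) = recurs m (ℤ.<⇒≤ k<m) in n , ℤ.<-≤-trans k<m m≤n , rest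
      after : Stage → Stage
      after (n , k<n , _ , p , n<p , _) = next p (ℤ.<-trans k<n n<p)
      stage : ℕ → Stage
      -- Searching from k + 1 makes the first link nonempty.
      stage zero    = next (k + 1ℤ) (to i+1≤k⇔i<k ℤ.≤-refl)
      stage (suc n) = after (stage n)
      c : ℕ → ℤ
      c zero    = k
      c (suc n) = proj₁ (stage n)
      after-< : ∀ s → proj₁ s < proj₁ (after s)
      after-< (n , k<n , _ , p , n<p , _) =
        let (_ , p≤n′ , _) = recurs p (ℤ.<⇒≤ (ℤ.<-trans k<n n<p)) in ℤ.<-≤-trans n<p p≤n′
      after-link : ∀ s → t w (proj₁ s) (proj₁ (after s)) ≡ e
      after-link (n , k<n , _ , p , n<p , np≡e , kp≡e) =
        let k≤p = ℤ.<⇒≤ (ℤ.<-trans k<n n<p)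
            (n′ , p≤n′ , kn′≡e , _) = recurs p k≤p
        in trans (t-join (ℤ.<⇒≤ n<p) p≤n′ k≤p p≤n′ (trans np≡e (sym kp≡e)) refl) kn′≡e
      ascend : ∀ n → c n < c (suc n)
      ascend zero    = proj₁ (proj₂ (stage 0))
      ascend (suc n) = after-< (stage n)
      link : ∀ n → t w (c n) (c (suc n)) ≡ e
      link zero    = proj₁ (proj₂ (proj₂ (stage 0)))
      link (suc n) = after-link (stage n)

    right-tail-determines : ∀ {w w′ j j′ s e} → RightTail (t w) j s e → RightTail (t w′) j′ s e →
      ty T w (j ≤_) ≡ ty T w′ (j′ ≤_)
    right-tail-determines {w} {w′} (k , j≤k , jk≡s , recurs) (k′ , j′≤k′ , jk′≡s , recurs′) = cut T k k′
      (trans (lower j≤k) (trans (trans jk≡s (sym jk′≡s)) (sym (lower j′≤k′))))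
      (trans (upper j≤k) (trans (chain-determines (chain recurs) (chain recurs′)) (sym (upper j′≤k′))))
      where
      lower : ∀ {w j k} → j ≤ k → ty T w ((j ≤_) ∩ (_< k)) ≡ t w j k
      lower j≤k = local T id id (λ _ → refl)
      upper : ∀ {w j k} → j ≤ k → ty T w ((j ≤_) ∩ (k ≤_)) ≡ ty T w (k ≤_)
      upper j≤k = local T proj₂ (λ k≤m → ℤ.≤-trans j≤k k≤m , k≤m) (λ _ → refl)

  -- Left-infinite parts by reflection.

  right⇒left : ∀ {N} {f g : ℤ → ℤ → Fin N} {j s e} → (∀ a b → f a b ≡ g (- b) (- a)) →
    RightTail f j s e → LeftTail g (- j) s e
  right⇒left f≡g (k , j≤k , jk≡s , recurs) = - k , ℤ.neg-mono-≤ j≤k , trans (sym (f≡g _ _)) jk≡s , λ m m≤-k →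
    let (n , -m≤n , kn≡e , p , n<p , np≡e , kp≡e) = recurs (- m) (subst (_≤ - m) (ℤ.neg-involutive k) (ℤ.neg-mono-≤ m≤-k))
    in - n , subst (- n ≤_) (ℤ.neg-involutive m) (ℤ.neg-mono-≤ -m≤n) , trans (sym (f≡g _ _)) kn≡e ,
       - p , ℤ.neg-mono-< n<p , trans (sym (f≡g _ _)) np≡e , trans (sym (f≡g _ _)) kp≡e

  left⇒right : ∀ {N} {f g : ℤ → ℤ → Fin N} {i s e} → (∀ a b → f a b ≡ g (- b) (- a)) →
    LeftTail f i s e → RightTail g (- i) s e
  left⇒right f≡g (k , k≤i , ki≡s , recurs) = - k , ℤ.neg-mono-≤ k≤i , trans (sym (f≡g _ _)) ki≡s , λ m -k≤m →
    let (n , n≤-m , nk≡e , p , p<n , pn≡e , pk≡e) = recurs (- m) (subst (- m ≤_) (ℤ.neg-involutive k) (ℤ.neg-mono-≤ -k≤m))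
    in - n , subst (_≤ - n) (ℤ.neg-involutive m) (ℤ.neg-mono-≤ n≤-m) , trans (sym (f≡g _ _)) nk≡e ,
       - p , ℤ.neg-mono-< p<n , trans (sym (f≡g _ _)) pn≡e , trans (sym (f≡g _ _)) pk≡e

  i≤νk⇔k<-i : ∀ {i k} → i ≤ ν k ⇔ k < - i
  i≤νk⇔k<-i {i} {k} = mk⇔
    (λ le → subst (_< - i) (ℤ.neg-involutive k) (ℤ.neg-mono-< (ℤ.i≤pred[j]⇒i<j le)))
    (λ lt → ℤ.i<j⇒i≤pred[j] (subst (_< - k) (ℤ.neg-involutive i) (ℤ.neg-mono-< lt)))

  νk<i⇔-i≤k : ∀ {i k} → ν k < i ⇔ - i ≤ k
  νk<i⇔-i≤k = mk⇔ (λ lt → ℤ.≮⇒≥ λ k<-i → ℤ.≤⇒≯ (from i≤νk⇔k<-i k<-i) lt)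
    (λ le → ℤ.≰⇒> λ i≤νk → ℤ.≤⇒≯ le (to i≤νk⇔k<-i i≤νk))

  module LeftTails {Σ : Set} (T : Types Σ) where

    open Segments T
    module Rev = Segments (reverse T)
    module RevTails = Tails (reverse T)

    reverse-t : ∀ w a b → Rev.t (w ∘ ν) a b ≡ t w (- b) (- a)
    reverse-t w a b = local T (λ (a≤ , <b) → to νk<i⇔-i≤k <b , to i≤νk⇔k<-i a≤)
      (λ (-b≤ , <-a) → from i≤νk⇔k<-i <-a , from νk<i⇔-i≤k -b≤) (λ {k} _ → cong w (ν-involutive k))

    t-reverse : ∀ w a b → t w a b ≡ Rev.t (w ∘ ν) (- b) (- a)
    t-reverse w a b = trans (cong₂ (t w) (sym (ℤ.neg-involutive a)) (sym (ℤ.neg-involutive b))) (sym (reverse-t w (- b) (- a)))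

    abstract
      left-tail-exists : ∀ w i → ∃₂ (LeftTail (t w) i)
      left-tail-exists w i = let (s , e , tail) = RevTails.right-tail-exists (w ∘ ν) (- i) in
        s , e , subst (λ i → LeftTail (t w) i s e) (ℤ.neg-involutive i) (right⇒left (reverse-t w) tail)

    left-tail-determines : ∀ {w w′ i i′ s e} → LeftTail (t w) i s e → LeftTail (t w′) i′ s e →
      ty T w (_< i) ≡ ty T w′ (_< i′)
    left-tail-determines {w} {w′} {i} {i′} tail tail′ = trans (sym (before w i))
      (trans (RevTails.right-tail-determines {w ∘ ν} {w′ ∘ ν} (left⇒right (t-reverse w) tail)
        (left⇒right (t-reverse w′) tail′)) (before w′ i′))
      where
      before : ∀ w i → ty (reverse T) (w ∘ ν) (- i ≤_) ≡ ty T w (_< i)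
      before w i = local T (λ le → subst (_ <_) (ℤ.neg-involutive i) (to i≤νk⇔k<-i le))
        (λ lt → from i≤νk⇔k<-i (subst (_ <_) (sym (ℤ.neg-involutive i)) lt)) (λ {k} _ → cong w (ν-involutive k))

  -- Types of infinite parts are definable.

  module RegularTails (T : Types Λ) {V : Set} (vs : List V) where

    open Segments T
    open RegularSegments T
    open Tails T
    open LeftTails T using (left-tail-exists; left-tail-determines)
    open Definability vs

    private M = T .N

    def-< : Definable (λ _ i j → i < j)
    def-< = def-resp (λ _ → mk⇔ proj₁ (_, tt)) (def-○ (def-const ⊤))

    RightRecurrent : Fin M → Word Λ → ℤ → Set
    RightRecurrent e w k = ∀ m → k ≤ m → ∃[ n ] m ≤ n × t w k n ≡ e × ∃[ p ] n < p × t w n p ≡ e × t w k p ≡ e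

    LeftRecurrent : Fin M → Word Λ → ℤ → Set
    LeftRecurrent e w k = ∀ m → m ≤ k → ∃[ n ] n ≤ m × t w n k ≡ e × ∃[ p ] p < n × t w p n ≡ e × t w p k ≡ e

    -- ◊r forgets the left end point k; so the type of [k , n) is computed from those of [k , m) and [m , n).
    def-right-recurrent : ∀ e → Definable (λ ρ _ k → RightRecurrent e (letters ρ) k)
    def-right-recurrent e = def-resp
      (λ _ → mk⇔ (λ f m k≤m → to (visit k≤m) (decidable-stable lem λ ¬v → f (m , k≤m , ¬v)))
                 (λ f (m , k≤m , ¬v) → ¬v (from (visit k≤m) (f m k≤m))))
      (def-¬ (def-◊r (def-¬ (def-∃ λ x → def-∧ (def-t vs x) (def-∧ (def-const (mul e e ≡ e))
        (def-◊r (def-∧ (def-∃ λ y → def-∧ (def-t vs y) (def-const (mul x y ≡ e)))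
          (def-◊r (def-∧ def-< (def-t vs e))))))))))
      where
      -- Given that [k, n) and [n, p) have type e, the condition on [k, p) amounts to `mul e e ≡ e`,
      -- which mentions no position.
      visit : ∀ {w k m} → k ≤ m →
        (∃[ x ] t w k m ≡ x × mul e e ≡ e × ∃[ n ] m ≤ n × (∃[ y ] t w m n ≡ y × mul x y ≡ e) ×
          ∃[ p ] n ≤ p × n < p × t w n p ≡ e) ⇔
        (∃[ n ] m ≤ n × t w k n ≡ e × ∃[ p ] n < p × t w n p ≡ e × t w k p ≡ e)
      visit {w} {k} {m} k≤m = mk⇔
        (λ { (_ , refl , ee≡e , n , m≤n , (_ , refl , xy≡e) , p , _ , n<p , np≡e) →
             let kn≡e = trans (t-mul k≤m m≤n) xy≡e in
             n , m≤n , kn≡e , p , n<p , np≡e ,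
             trans (t-mul (ℤ.≤-trans k≤m m≤n) (ℤ.<⇒≤ n<p)) (trans (cong₂ mul kn≡e np≡e) ee≡e) })
        (λ (n , m≤n , kn≡e , p , n<p , np≡e , kp≡e) →
             _ , refl , trans (cong₂ mul (sym kn≡e) (sym np≡e)) (trans (sym (t-mul (ℤ.≤-trans k≤m m≤n) (ℤ.<⇒≤ n<p))) kp≡e) ,
             n , m≤n , (_ , refl , trans (sym (t-mul k≤m m≤n)) kn≡e) , p , ℤ.<⇒≤ n<p , n<p , np≡e)

    -- Now it is the right end point that `◊l` forgets, and the factors of `mul` appear in the
    -- opposite order.
    def-left-recurrent : ∀ e → Definable (λ ρ k _ → LeftRecurrent e (letters ρ) k)
    def-left-recurrent e = def-resp
      (λ _ → mk⇔ (λ f m m≤k → to (visit m≤k) (decidable-stable lem λ ¬v → f (m , m≤k , ¬v)))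
                 (λ f (m , m≤k , ¬v) → ¬v (from (visit m≤k) (f m m≤k))))
      (def-¬ (def-◊l (def-¬ (def-∃ λ x → def-∧ (def-t vs x) (def-∧ (def-const (mul e e ≡ e))
        (def-◊l (def-∧ (def-∃ λ y → def-∧ (def-t vs y) (def-const (mul y x ≡ e)))
          (def-◊l (def-∧ def-< (def-t vs e))))))))))
      where
      visit : ∀ {w k m} → m ≤ k →
        (∃[ x ] t w m k ≡ x × mul e e ≡ e × ∃[ n ] n ≤ m × (∃[ y ] t w n m ≡ y × mul y x ≡ e) ×
          ∃[ p ] p ≤ n × p < n × t w p n ≡ e) ⇔
        (∃[ n ] n ≤ m × t w n k ≡ e × ∃[ p ] p < n × t w p n ≡ e × t w p k ≡ e)
      visit {w} {k} {m} m≤k = mk⇔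
        (λ { (_ , refl , ee≡e , n , n≤m , (_ , refl , yx≡e) , p , _ , p<n , pn≡e) →
             let nk≡e = trans (t-mul n≤m m≤k) yx≡e in
             n , n≤m , nk≡e , p , p<n , pn≡e ,
             trans (t-mul (ℤ.<⇒≤ p<n) (ℤ.≤-trans n≤m m≤k)) (trans (cong₂ mul pn≡e nk≡e) ee≡e) })
        (λ (n , n≤m , nk≡e , p , p<n , pn≡e , pk≡e) →
             _ , refl , trans (cong₂ mul (sym pn≡e) (sym nk≡e)) (trans (sym (t-mul (ℤ.<⇒≤ p<n) (ℤ.≤-trans n≤m m≤k))) pk≡e) ,
             n , n≤m , (_ , refl , trans (sym (t-mul n≤m m≤k)) nk≡e) , p , ℤ.<⇒≤ p<n , p<n , pn≡e)

    def-right-tail : ∀ s e → Definable (λ ρ _ j → RightTail (t (letters ρ)) j s e)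
    def-right-tail s e = def-◊r (def-∧ (def-t vs s) (def-right-recurrent e))

    def-left-tail : ∀ s e → Definable (λ ρ i _ → LeftTail (t (letters ρ)) i s e)
    def-left-tail s e = def-◊l (def-∧ (def-t vs s) (def-left-recurrent e))

    -- Some pair (s, e) fits every tail, and the pair determines the type. So the formula is a
    -- disjunction over the pairs realised by some tail of type x.
    def-right-type : ∀ x → Definable (λ ρ _ j → ty T (letters ρ) (j ≤_) ≡ x)
    def-right-type x = def-resp
      (λ {ρ} {_} {j} _ → mk⇔ (λ (s , e , (w , k , tail′ , e′) , tail) → trans (right-tail-determines tail tail′) e′)
        (λ e′ → let (s , e , tail) = right-tail-exists (letters ρ) j in s , e , (letters ρ , j , tail , e′) , tail))
      (def-∃ λ s → def-∃ λ e → def-∧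
        (def-const (∃₂ λ w j → RightTail (t w) j s e × ty T w (j ≤_) ≡ x)) (def-right-tail s e))

    def-left-type : ∀ x → Definable (λ ρ i _ → ty T (letters ρ) (_< i) ≡ x)
    def-left-type x = def-resp
      (λ {ρ} {i} _ → mk⇔ (λ (s , e , (w , k , tail′ , e′) , tail) → trans (left-tail-determines tail tail′) e′)
        (λ e′ → let (s , e , tail) = left-tail-exists (letters ρ) i in s , e , (letters ρ , i , tail , e′) , tail))
      (def-∃ λ s → def-∃ λ e → def-∧
        (def-const (∃₂ λ w i → LeftTail (t w) i s e × ty T w (_< i) ≡ x)) (def-left-tail s e))

  -- Quantification over the variables outside a list is definable.

  module Projection {V : Set} (A : Formula V) (vs : List V) where

    open Definability vs

    Framed : Set → Set
    Framed Σ = Bool × Bool × Σ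

    -- Here the end points are encoded by up-sets, so that the encoding is constant on each of the
    -- three parts (-∞ , i), [i , j) and [j , ∞).
    frame : ∀ {Σ} → ℤ → ℤ → Word Σ → Word (Framed Σ)
    frame i j w k = does (i ≤? k) , does (j ≤? k) , w k

    -- Recovers an end point from its up-set.
    Starts : ∀ {Σ} → Pred Σ 0ℓ → Word Σ → ℤ → Set
    Starts c w i = w i ∈ c × ∀ m → m < i → ¬ w m ∈ c

    rec-starts : ∀ {Σ n} (c : Pred Σ 0ℓ) (x : Fin n) → Recognisable (λ w π → Starts c w (Vec.lookup π x))
    rec-starts c x = rec-× (rec-letter c x) (rec-∀ (rec-→ (rec-< zero (suc x)) (rec-¬ (rec-letter c zero))))

    starts⇒≡ : ∀ {Σ} {c : Pred Σ 0ℓ} {w i k} → (∀ m → w m ∈ c ⇔ i ≤ m) → Starts c w k → i ≡ k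
    starts⇒≡ {i = i} h (ck , first) = ℤ.≤-antisym (to (h _) ck) (ℤ.≮⇒≥ λ i<k → first i i<k (from (h i) ℤ.≤-refl))

    ≡⇒starts : ∀ {Σ} {c : Pred Σ 0ℓ} {w i} → (∀ m → w m ∈ c ⇔ i ≤ m) → Starts c w i
    ≡⇒starts {i = i} h = from (h i) ℤ.≤-refl , λ m m<i cm → ℤ.≤⇒≯ (to (h m) cm) m<i

    content : Framed (V → Bool) → V → Bool
    content = proj₂ ∘ proj₂

    On₁ On₂ : ∀ {Σ} → Pred (Framed Σ) 0ℓ
    On₁ (b , _ , _) = T b
    On₂ (_ , b , _) = T b

    abstract
      -- A property without free position variables: the end points are quantified and read off the
      -- frame.
      framed-satisfaction : Recognisable {Framed (V → Bool)} {0} λ w _ →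
        ∃[ i ] ∃[ j ] Starts On₁ w i × Starts On₂ w j × trace content w [ i , j ]⊨ A
      framed-satisfaction = rec-∃ (rec-∃ (rec-× (rec-starts On₁ (suc zero)) (rec-× (rec-starts On₂ zero)
        (satisfaction-recognisable A content (suc zero) zero))))

    -- Projecting along this relation quantifies over all variables outside `vs` at once.
    Hide : Framed Λ → Vec Bool 0 × Framed (V → Bool) → Set
    Hide (x , y , a) (_ , x′ , y′ , b) = x ≡ x′ × y ≡ y′ × List.map b vs ≡ a

    abstract
      R : Types (Framed Λ)
      R = project Hide (framed-satisfaction .types)

      R-reflects : ∀ {w w′ D D′ ŵ} → ty R w D ≡ ty R w′ D′ → Lift Hide w ŵ D →
        ∃[ ŵ′ ] Lift Hide w′ ŵ′ D′ × ty (framed-satisfaction .types) ŵ′ D′ ≡ ty (framed-satisfaction .types) ŵ D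
      R-reflects {w} {w′} {D} {D′} {ŵ} =
        project-reflects {E = Hide} {framed-satisfaction .types} {w} {w′} {D} {D′} {ŵ}

    -- The semantics of ∃p₁...pₙ. A, the pᵢ being the variables of `A` outside `vs`.
    Projected : Word Λ → ℤ → ℤ → Set
    Projected w i j = ∃[ ρ ] (∀ k → List.map (ρ k) vs ≡ w k) × trace id ρ [ i , j ]⊨ A

    -- Equal types give a lift of the second word on which the framed property still holds; its
    -- frame bits force the quantified end points to be i′ and j′.
    transfer : ∀ {w w′ i j i′ j′} → ty R (frame i j w) U ≡ ty R (frame i′ j′ w′) U →
      Projected w i j → Projected w′ i′ j′
    transfer {w} {w′} {i} {j} {i′} {j′} eq (ρ , hides , holds) =
      unframe (R-reflects {ŵ = mark Vec.[] (frame i j ρ)} eq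
        (λ {k} _ → refl , refl , hides k))
      where
      does⇔ : ∀ {a} m → T (does (a ≤? m)) ⇔ a ≤ m
      does⇔ {a} m = mk⇔ (does⇒ (a ≤? m)) (⇒does (a ≤? m))
      no-marks : ∀ (v : Vec Bool 0) → Vec.[] ≡ v
      no-marks Vec.[] = refl
      unframe : ∃[ ŵ ] Lift Hide (frame i′ j′ w′) ŵ U × ty (framed-satisfaction .types) ŵ U ≡
                  ty (framed-satisfaction .types) (mark Vec.[] (frame i j ρ)) U → Projected w′ i′ j′
      unframe (ŵ , lift , e) = read (framed-satisfaction .decide {frame i j ρ} {proj₂ ∘ ŵ} {Vec.[]} {Vec.[]}
          (trans (sym e) (local (framed-satisfaction .types) id id
            (λ {k} _ → cong (_, proj₂ (ŵ k)) (sym (no-marks (proj₁ (ŵ k)))))))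
          (i , j , ≡⇒starts {c = On₁} {frame i j ρ} does⇔ , ≡⇒starts {c = On₂} {frame i j ρ} does⇔ , holds))
        where
        at₁ : ∀ m → proj₂ (ŵ m) ∈ On₁ ⇔ i′ ≤ m
        at₁ m = subst (λ b → T b ⇔ i′ ≤ m) (proj₁ (lift {m} tt)) (does⇔ m)
        at₂ : ∀ m → proj₂ (ŵ m) ∈ On₂ ⇔ j′ ≤ m
        at₂ m = subst (λ b → T b ⇔ j′ ≤ m) (proj₁ (proj₂ (lift {m} tt))) (does⇔ m)
        read : (∃[ i ] ∃[ j ] Starts On₁ (proj₂ ∘ ŵ) i × Starts On₂ (proj₂ ∘ ŵ) j ×
                 trace content (proj₂ ∘ ŵ) [ i , j ]⊨ A) →
               Projected w′ i′ j′
        read (_ , _ , start₁ , start₂ , h) = content ∘ proj₂ ∘ ŵ , (λ k → proj₂ (proj₂ (lift tt))) ,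
          subst₂ (λ i j → trace id (content ∘ proj₂ ∘ ŵ) [ i , j ]⊨ A)
            (sym (starts⇒≡ {c = On₁} {proj₂ ∘ ŵ} at₁ start₁)) (sym (starts⇒≡ {c = On₂} {proj₂ ∘ ŵ} at₂ start₂)) h

    -- On each of the three parts the frame bits are fixed, so the types of framed words become
    -- types of plain words.
    part : Bool → Bool → Types Λ
    part x y = relabel (λ a → x , y , a) R

    before within after : Types Λ
    before = part false false
    within = part true false
    after  = part true true

    assemble : ∀ {w w′ i j i′ j′} → i ≤ j → i′ ≤ j′ → ty before w (_< i) ≡ ty before w′ (_< i′) →
      ty within w ⟦ i , j ⟩ ≡ ty within w′ ⟦ i′ , j′ ⟩ → ty after w (j ≤_) ≡ ty after w′ (j′ ≤_) →
      ty R (frame i j w) U ≡ ty R (frame i′ j′ w′) U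
    assemble {w} {w′} {i} {j} {i′} {j′} i≤j i′≤j′ l m r = cut R i i′
      (trans (low i≤j) (trans l (sym (low i′≤j′))))
      (cut R j j′ (trans (mid i≤j) (trans m (sym (mid i′≤j′)))) (trans (high i≤j) (trans r (sym (high i′≤j′)))))
      where
      tag : ∀ {a b c d : Bool} {x : Λ} → a ≡ c → b ≡ d → (a , b , x) ≡ (c , d , x)
      tag refl refl = refl
      low : ∀ {w i j} → i ≤ j → ty R (frame i j w) (U ∩ (_< i)) ≡ ty before w (_< i)
      low {i = i} {j} i≤j = local R proj₂ (tt ,_) (λ {k} (_ , k<i) →
        tag (dec-false (i ≤? k) (ℤ.<⇒≱ k<i)) (dec-false (j ≤? k) (ℤ.<⇒≱ (ℤ.<-≤-trans k<i i≤j))))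
      mid : ∀ {w i j} → i ≤ j → ty R (frame i j w) ((U ∩ (i ≤_)) ∩ (_< j)) ≡ ty within w ⟦ i , j ⟩
      mid {i = i} {j} i≤j = local R (λ ((_ , i≤k) , k<j) → i≤k , k<j) (λ (i≤k , k<j) → (tt , i≤k) , k<j)
        (λ {k} ((_ , i≤k) , k<j) → tag (dec-true (i ≤? k) i≤k) (dec-false (j ≤? k) (ℤ.<⇒≱ k<j)))
      high : ∀ {w i j} → i ≤ j → ty R (frame i j w) ((U ∩ (i ≤_)) ∩ (j ≤_)) ≡ ty after w (j ≤_)
      high {i = i} {j} i≤j = local R proj₂ (λ j≤k → (tt , ℤ.≤-trans i≤j j≤k) , j≤k)
        (λ {k} ((_ , i≤k) , j≤k) → tag (dec-true (i ≤? k) i≤k) (dec-true (j ≤? k) j≤k))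

    -- A finite disjunction over the triples of types of the three parts that are realised by some
    -- interval with the projected property.
    def-projected : Definable (λ ρ → Projected (letters ρ))
    def-projected = def-resp
      (λ {ρ} {i} {j} i≤j → mk⇔
        (λ (_ , _ , _ , (w , i′ , j′ , i′≤j′ , l′ , m′ , r′ , p) , l , m , r) →
          transfer (assemble i′≤j′ i≤j (trans l′ (sym l)) (trans m′ (sym m)) (trans r′ (sym r))) p)
        (λ p → _ , _ , _ , (letters ρ , i , j , i≤j , refl , refl , refl , p) , refl , refl , refl))
      (def-∃ λ l → def-∃ λ m → def-∃ λ r → def-∧ (def-const (Realised l m r))
        (def-∧ (RegularTails.def-left-type before vs l)
          (def-∧ (RegularSegments.def-t within vs m) (RegularTails.def-right-type after vs r))))
      where
      Realised : Fin (R .N) → Fin (R .N) → Fin (R .N) → Set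
      Realised l m r = ∃[ w ] ∃[ i ] ∃[ j ] i ≤ j × ty before w (_< i) ≡ l × ty within w ⟦ i , j ⟩ ≡ m ×
        ty after w (j ≤_) ≡ r × Projected w i j

  -- Dependence on occurring variables, and the uniform interpolant.

  coincidence : ∀ {V} (A : Formula V) {σ σ′ : Trace V} → (∀ {q} → q ∈ Var A → ∀ k → q ∈ σ k ⇔ q ∈ σ′ k) →
    ∀ {i j} → σ [ i , j ]⊨ A ⇔ σ′ [ i , j ]⊨ A
  coincidence ⊥′ h = mk⇔ id id
  coincidence (var q) h = h refl _
  coincidence (A ⊃ B) h = mk⇔
    (λ { (inj₁ ¬a) → inj₁ (¬a ∘ from (coincidence A (h ∘ inj₁))) ; (inj₂ b) → inj₂ (to (coincidence B (h ∘ inj₂)) b) })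
    (λ { (inj₁ ¬a) → inj₁ (¬a ∘ to (coincidence A (h ∘ inj₁))) ; (inj₂ b) → inj₂ (from (coincidence B (h ∘ inj₂)) b) })
  coincidence (○ A) h = mk⇔ (map₂ (to (coincidence A h))) (map₂ (from (coincidence A h)))
  coincidence (A ⨾ B) h = mk⇔
    (λ (k , i≤k , k≤j , a , b) → k , i≤k , k≤j , to (coincidence A (h ∘ inj₁)) a , to (coincidence B (h ∘ inj₂)) b)
    (λ (k , i≤k , k≤j , a , b) → k , i≤k , k≤j , from (coincidence A (h ∘ inj₁)) a , from (coincidence B (h ∘ inj₂)) b)
  coincidence (A *) h = mk⇔ (Star.map (map₂ (to (coincidence A h)))) (Star.map (map₂ (from (coincidence A h))))
  coincidence (◊l A) h = mk⇔ (map₂ (map₂ (to (coincidence A h)))) (map₂ (map₂ (from (coincidence A h))))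
  coincidence (◊r A) h = mk⇔ (map₂ (map₂ (to (coincidence A h)))) (map₂ (map₂ (from (coincidence A h))))

  variables : ∀ {V} → Formula V → List V
  variables ⊥′      = []
  variables (var q) = q ∷ []
  variables (A ⊃ B) = variables A List.++ variables B
  variables (○ A)   = variables A
  variables (A ⨾ B) = variables A List.++ variables B
  variables (A *)   = variables A
  variables (◊l A)  = variables A
  variables (◊r A)  = variables A

  Var⊆variables : ∀ {V} (A : Formula V) → Var A ⊆ (_∈ₗ variables A)
  Var⊆variables (var q) refl     = here refl
  Var⊆variables (A ⊃ B) (inj₁ p) = ∈-++⁺ˡ (Var⊆variables A p)
  Var⊆variables (A ⊃ B) (inj₂ p) = ∈-++⁺ʳ (variables A) (Var⊆variables B p)
  Var⊆variables (○ A)   p        = Var⊆variables A p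
  Var⊆variables (A ⨾ B) (inj₁ p) = ∈-++⁺ˡ (Var⊆variables A p)
  Var⊆variables (A ⨾ B) (inj₂ p) = ∈-++⁺ʳ (variables A) (Var⊆variables B p)
  Var⊆variables (A *)   p        = Var⊆variables A p
  Var⊆variables (◊l A)  p        = Var⊆variables A p
  Var⊆variables (◊r A)  p        = Var⊆variables A p

  map-agree : ∀ {V : Set} {f g : V → Bool} {vs q} → List.map f vs ≡ List.map g vs → q ∈ₗ vs → f q ≡ g q
  map-agree {vs = _ ∷ _} eq (here refl) = proj₁ (List.∷-injective eq)
  map-agree {vs = _ ∷ _} eq (there q∈)  = map-agree (proj₂ (List.∷-injective eq)) q∈

  bits : ∀ {V} → Trace V → Word (V → Bool)
  bits σ k q = does (lem {q ∈ σ k})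

  ⊨-bits : ∀ {V} (A : Formula V) σ {i j} → trace id (bits σ) [ i , j ]⊨ A ⇔ σ [ i , j ]⊨ A
  ⊨-bits A σ = coincidence A λ _ k → mk⇔ (does⇒ lem) (⇒does lem)

  -- `C` defines the projection of `A` to the variables in `U`. For `A ⊃ C` a trace is its own
  -- witness; for `C ⊃ B` a witness differs from the given trace, up to variables not in `A`, only
  -- on variables that `B` lacks.
  uniform-interpolant : ∀ {V : Set} (A : Formula V) (U : Pred V 0ℓ) → U ⊆ Var A →
    ∃[ C ] (Var C ⊆ U) × (⊨ (A ⊃ C)) × ((B : Formula V) → Var A ∩ Var B ≐ U → ⊨ (A ⊃ B) → ⊨ (C ⊃ B))
  uniform-interpolant {V} A U U⊆A = C , proj₂ ∘ ∈-filter⁻ U? {xs = variables A} ∘ over , A⊨C , C⊨B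
    where
    U? : ∀ q → Dec (q ∈ U)
    U? _ = lem
    vs : List V
    vs = List.filter U? (variables A)
    open Definability vs using (letters; module Definable)
    open Projection A vs
    open Definable def-projected using (over; defines) renaming (formula to C)
    A⊨C : ⊨ (A ⊃ C)
    A⊨C σ i j i≤j = →⇒¬⊎ λ a →
      to (⊨-bits C σ) (from (defines (bits σ) i≤j) (bits σ , (λ _ → refl) , from (⊨-bits A σ) a))
    C⊨B : ∀ B → Var A ∩ Var B ≐ U → ⊨ (A ⊃ B) → ⊨ (C ⊃ B)
    C⊨B B (AB⊆U , _) A⊨B σ i j i≤j = →⇒¬⊎ λ c →
      extract (to (defines (bits σ) i≤j) (from (⊨-bits C σ) c))
      where
      extract : Projected (letters (bits σ)) i j → σ [ i , j ]⊨ B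
      extract (ρ , agree , a) = to (coincidence B τ≈σ) (¬⊎⇒→ (A⊨B τ i j i≤j) (to (coincidence A ρ≈τ) a))
        where
        -- Follows the witness `ρ` on the variables of `A`, so that `A` holds, and `σ` elsewhere. A
        -- variable of both `A` and `B` lies in `U`, where `ρ` agrees with `σ`.
        τ : Trace V
        τ k q = (q ∈ Var A × T (ρ k q)) ⊎ (¬ q ∈ Var A × q ∈ σ k)
        ρ≈τ : ∀ {q} → q ∈ Var A → ∀ k → T (ρ k q) ⇔ q ∈ τ k
        ρ≈τ q∈A k = mk⇔ (λ x → inj₁ (q∈A , x)) λ { (inj₁ (_ , x)) → x ; (inj₂ (q∉A , _)) → contradiction q∈A q∉A }
        ρ≈σ : ∀ {q} → q ∈ Var A → q ∈ Var B → ∀ k → T (ρ k q) ⇔ q ∈ σ k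
        ρ≈σ {q} q∈A q∈B k = mk⇔ (λ x → does⇒ lem (subst T same x)) (λ x → subst T (sym same) (⇒does lem x))
          where
          same : ρ k q ≡ bits σ k q
          same = map-agree (agree k) (∈-filter⁺ U? (Var⊆variables A q∈A) (AB⊆U (q∈A , q∈B)))
        τ≈σ : ∀ {q} → q ∈ Var B → ∀ k → q ∈ τ k ⇔ q ∈ σ k
        τ≈σ {q} q∈B k with lem {q ∈ Var A}
        ... | yes q∈A = mk⇔ (to (ρ≈σ q∈A q∈B k) ∘ from (ρ≈τ q∈A k)) (to (ρ≈τ q∈A k) ∘ from (ρ≈σ q∈A q∈B k))
        ... | no q∉A  = mk⇔ (λ { (inj₁ (q∈A , _)) → contradiction q∈A q∉A ; (inj₂ (_ , x)) → x }) (λ x → inj₂ (q∉A , x))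

corollary19 : ExcludedMiddle 0ℓ → (V : Set) →
    ((A B : Formula V) → ⊨ (A ⊃ B) →
    ∃[ C ] (Var C ⊆ Var A ∩ Var B) × (⊨ (A ⊃ C)) × (⊨ (C ⊃ B)))
    ×
    ((A : Formula V) (U : Pred V 0ℓ) → U ⊆ Var A →
    ∃[ C ] (Var C ⊆ U) × (⊨ (A ⊃ C)) ×
    ((B : Formula V) → Var A ∩ Var B ≐ U → ⊨ (A ⊃ B) → ⊨ (C ⊃ B)))
corollary19 lem V = (λ A B A⊨B →
    let (C , C⊆U , A⊨C , C⊨) = uniform-interpolant A (Var A ∩ Var B) proj₁
    in C , C⊆U , A⊨C , C⊨ B (id , id) A⊨B) , uniform-interpolant
  where open Classical lem
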